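{- Let $A \in \mathbb{Z}^{m\times n}$, $b \in \mathbb{Q}^{m}$, and $\operatorname{rank}(A) = n$. Let $\mathcal{P} = \{x \in \mathbb{R}^n : A x \leq b\}$. Then $$ |\mathrm{vert}(\mathcal{P})| \leq 2^n \cdot \bigl(\gamma_{1,\infty}(A)\bigr)^n \leq \bigl(2 \|A\|_{\max}\bigr)^n \cdot \bigl(\overline{\mathrm{ts}}(A)\bigr)^n . $$
   Context: $\mathrm{vert}(\mathcal{P})$ is the set of vertices of $\mathcal{P}$. $\|A\|_{\max} = \max_{i,j}|A_{ij}|$. For a matrix $B$: $\|B\|_1 = \max_i \sum_j |B_{ij}|$ and $\|B\|_\infty = \max_j \sum_i |B_{ij}|$. A non-degenerate sub-matrix of $A$ is a square sub-matrix (arbitrary row and column index sets of equal size) with non-zero determinant. For $p \in \{1,\infty\}$, $\gamma_p(A) = \max\{\|B\|_p : B \text{ is a non-degenerate sub-matrix of } A\}$, and $\gamma_{1,\infty}(A) = \min\{\gamma_1(A), \gamma_\infty(A)\}$. Let $\mathrm{rs}(B)$ and $\mathrm{cs}(B)$ be the maximum number of non-zero entries in a row, respectively in a column, of $B$. Then $\overline{\mathrm{rs}}(A) = \max\{\mathrm{rs}(B)\}$ and $\overline{\mathrm{cs}}(A) = \max\{\mathrm{cs}(B)\}$, the maxima being over non-degenerate sub-matrices $B$ of $A$, and $\overline{\mathrm{ts}}(A) = \min\{\overline{\mathrm{rs}}(A), \overline{\mathrm{cs}}(A)\}$. -}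

module Defs where

open import Algebra.Bundles using (CommutativeMonoid)
open import Algebra.Bundles.Raw using (RawMonoid)
import Algebra.Definitions.RawMonoid as RawMonoidOps
import Algebra.Properties.CommutativeSemigroup as CommutativeSemigroupProperties
import Algebra.Properties.Ring as RingProperties
open import Data.Fin.Base using (Fin; zero; suc; toℕ; punchIn)
open import Data.Integer.Base as ℤ using (ℤ; 0ℤ; 1ℤ)
import Data.Integer.Properties as ℤ
open import Data.List.Base as List
  using (List; []; _∷_; _++_; concatMap; cartesianProductWith; filter; upTo)
open import Data.Nat.Base as ℕ using (ℕ; zero; suc)
import Data.Nat.Properties as ℕ
open import Data.Product.Base using (∃; ∃-syntax; _×_; _,_; proj₁; proj₂)
open import Data.Rational.Base as ℚ using (ℚ; 0ℚ; 1ℚ; ½; _/_)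
import Data.Rational.Properties as ℚ
open import Data.Vec.Base as Vec using (Vec; lookup)
open import Data.Vec.Functional as Vector using (Vector; toList)
open import Function.Definitions using (Injective)
open import Level using (0ℓ)
open import Relation.Binary.PropositionalEquality
  using (_≡_; sym; trans; cong; cong₂; subst)
open import Relation.Nullary.Decidable using (¬?)

private
  variable
    m n k : ℕ

-- Real numbers are Cauchy sequences of rationals; two of them are equal (_≈_)
-- when their difference is a null sequence.

IsCauchy : (ℕ → ℚ) → Set
IsCauchy x = ∀ ε → 0ℚ ℚ.< ε →
  ∃[ N ] ∀ i j → N ℕ.≤ i → N ℕ.≤ j → ℚ.∣ x i ℚ.- x j ∣ ℚ.< ε

record ℝ : Set where
  constructor mkℝ
  field
    seq    : ℕ → ℚ
    cauchy : IsCauchy seq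

open ℝ public

infix 4 _≈_ _≤_ _<_

_≈_ : ℝ → ℝ → Set
x ≈ y = ∀ ε → 0ℚ ℚ.< ε →
  ∃[ N ] ∀ i → N ℕ.≤ i → ℚ.∣ seq x i ℚ.- seq y i ∣ ℚ.< ε

_≤_ : ℝ → ℝ → Set
x ≤ y = ∀ ε → 0ℚ ℚ.< ε →
  ∃[ N ] ∀ i → N ℕ.≤ i → seq x i ℚ.≤ seq y i ℚ.+ ε

_<_ : ℝ → ℝ → Set
x < y = ∃[ ε ] 0ℚ ℚ.< ε ×
  ∃[ N ] ∀ i → N ℕ.≤ i → seq x i ℚ.+ ε ℚ.≤ seq y i

private
  open ℚ.≤-Reasoning
  open RingProperties ℚ.+-*-ring using (x[y-z]≈xy-xz; [y-z]x≈yx-zx)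

  interchange : ∀ a b c d → (a ℚ.+ b) ℚ.- (c ℚ.+ d) ≡ (a ℚ.- c) ℚ.+ (b ℚ.- d)
  interchange a b c d = trans
    (cong (a ℚ.+ b ℚ.+_) (ℚ.neg-distrib-+ c d))
    (CommutativeSemigroupProperties.interchange
      (CommutativeMonoid.commutativeSemigroup ℚ.+-0-commutativeMonoid)
      a b (ℚ.- c) (ℚ.- d))

  minus-plus : ∀ a b → a ≡ (a ℚ.- b) ℚ.+ b
  minus-plus a b = sym (trans (ℚ.+-assoc a (ℚ.- b) b)
    (trans (cong (a ℚ.+_) (ℚ.+-inverseˡ b)) (ℚ.+-identityʳ a)))

  product-minus : ∀ a b c d →
    a ℚ.* b ℚ.- c ℚ.* d ≡ a ℚ.* (b ℚ.- d) ℚ.+ d ℚ.* (a ℚ.- c)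
  product-minus a b c d = begin-equality
    a ℚ.* b ℚ.- c ℚ.* d
      ≡⟨ cong (ℚ._- c ℚ.* d) (minus-plus (a ℚ.* b) (a ℚ.* d)) ⟩
    (a ℚ.* b ℚ.- a ℚ.* d) ℚ.+ a ℚ.* d ℚ.- c ℚ.* d
      ≡⟨ ℚ.+-assoc (a ℚ.* b ℚ.- a ℚ.* d) (a ℚ.* d) (ℚ.- (c ℚ.* d)) ⟩
    (a ℚ.* b ℚ.- a ℚ.* d) ℚ.+ (a ℚ.* d ℚ.- c ℚ.* d)
      ≡⟨ cong₂ ℚ._+_ (sym (x[y-z]≈xy-xz a b d)) (sym ([y-z]x≈yx-zx d a c)) ⟩
    a ℚ.* (b ℚ.- d) ℚ.+ (a ℚ.- c) ℚ.* d
      ≡⟨ cong (a ℚ.* (b ℚ.- d) ℚ.+_) (ℚ.*-comm (a ℚ.- c) d) ⟩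
    a ℚ.* (b ℚ.- d) ℚ.+ d ℚ.* (a ℚ.- c) ∎

  half : ∀ {ε} → 0ℚ ℚ.< ε → 0ℚ ℚ.< ½ ℚ.* ε
  half {ε} 0<ε = ℚ.positive⁻¹ (½ ℚ.* ε) {{ℚ.pos*pos⇒pos ½ ε {{ℚ.positive 0<ε}}}}

  halves : ∀ ε → ½ ℚ.* ε ℚ.+ ½ ℚ.* ε ≡ ε
  halves ε = trans (sym (ℚ.*-distribʳ-+ ε ½ ½)) (ℚ.*-identityˡ ε)

  const-cauchy : ∀ q → IsCauchy (λ _ → q)
  const-cauchy q ε 0<ε = 0 , λ _ _ _ _ →
    subst (λ p → ℚ.∣ p ∣ ℚ.< ε) (sym (ℚ.+-inverseʳ q)) 0<ε

  +-cauchy : ∀ x y → IsCauchy x → IsCauchy y → IsCauchy (λ i → x i ℚ.+ y i)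
  +-cauchy x y cx cy ε 0<ε = Nx ℕ.⊔ Ny , bound
    where
    Nx = proj₁ (cx (½ ℚ.* ε) (half 0<ε))
    Ny = proj₁ (cy (½ ℚ.* ε) (half 0<ε))
    bound : ∀ i j → Nx ℕ.⊔ Ny ℕ.≤ i → Nx ℕ.⊔ Ny ℕ.≤ j →
            ℚ.∣ (x i ℚ.+ y i) ℚ.- (x j ℚ.+ y j) ∣ ℚ.< ε
    bound i j p q = begin-strict
      ℚ.∣ (x i ℚ.+ y i) ℚ.- (x j ℚ.+ y j) ∣
        ≡⟨ cong ℚ.∣_∣ (interchange (x i) (y i) (x j) (y j)) ⟩
      ℚ.∣ (x i ℚ.- x j) ℚ.+ (y i ℚ.- y j) ∣
        ≤⟨ ℚ.∣p+q∣≤∣p∣+∣q∣ (x i ℚ.- x j) (y i ℚ.- y j) ⟩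
      ℚ.∣ x i ℚ.- x j ∣ ℚ.+ ℚ.∣ y i ℚ.- y j ∣
        <⟨ ℚ.+-mono-<
             (proj₂ (cx (½ ℚ.* ε) (half 0<ε)) i j
               (ℕ.m⊔n≤o⇒m≤o Nx Ny p) (ℕ.m⊔n≤o⇒m≤o Nx Ny q))
             (proj₂ (cy (½ ℚ.* ε) (half 0<ε)) i j
               (ℕ.m⊔n≤o⇒n≤o Nx Ny p) (ℕ.m⊔n≤o⇒n≤o Nx Ny q)) ⟩
      ½ ℚ.* ε ℚ.+ ½ ℚ.* ε
        ≡⟨ halves ε ⟩
      ε ∎

  neg-cauchy : ∀ x → IsCauchy x → IsCauchy (λ i → ℚ.- x i)
  neg-cauchy x cx ε 0<ε = proj₁ (cx ε 0<ε) , λ i j p q →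
    subst (ℚ._< ε)
      (trans (sym (ℚ.∣-p∣≡∣p∣ (x i ℚ.- x j)))
             (cong ℚ.∣_∣ (ℚ.neg-distrib-+ (x i) (ℚ.- x j))))
      (proj₂ (cx ε 0<ε) i j p q)

  bounded : ∀ x → IsCauchy x →
            ∃[ B ] 0ℚ ℚ.< B × ∃[ N ] ∀ i → N ℕ.≤ i → ℚ.∣ x i ∣ ℚ.≤ B
  bounded x cx = B , 0<B , N , bound
    where
    0<1 : 0ℚ ℚ.< 1ℚ
    0<1 = ℚ.positive⁻¹ 1ℚ
    N = proj₁ (cx 1ℚ 0<1)
    B = 1ℚ ℚ.+ ℚ.∣ x N ∣
    0<B : 0ℚ ℚ.< B
    0<B = ℚ.+-mono-<-≤ 0<1 (ℚ.0≤∣p∣ (x N))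
    bound : ∀ i → N ℕ.≤ i → ℚ.∣ x i ∣ ℚ.≤ B
    bound i p = begin
      ℚ.∣ x i ∣
        ≡⟨ cong ℚ.∣_∣ (minus-plus (x i) (x N)) ⟩
      ℚ.∣ (x i ℚ.- x N) ℚ.+ x N ∣
        ≤⟨ ℚ.∣p+q∣≤∣p∣+∣q∣ (x i ℚ.- x N) (x N) ⟩
      ℚ.∣ x i ℚ.- x N ∣ ℚ.+ ℚ.∣ x N ∣
        ≤⟨ ℚ.+-monoˡ-≤ ℚ.∣ x N ∣
             (ℚ.<⇒≤ (proj₂ (cx 1ℚ 0<1) i N p ℕ.≤-refl)) ⟩
      B ∎

  shrink : ∀ B → 0ℚ ℚ.< B → ∀ ε → 0ℚ ℚ.< ε → ∃[ δ ] 0ℚ ℚ.< δ × B ℚ.* δ ≡ ε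
  shrink B 0<B ε 0<ε = δ , 0<δ , eq
    where
    instance
      _ : ℚ.Positive B
      _ = ℚ.positive 0<B
      _ : ℚ.NonZero B
      _ = ℚ.pos⇒nonZero B
      _ : ℚ.Positive ε
      _ = ℚ.positive 0<ε
      _ : ℚ.Positive (ℚ.1/ B)
      _ = ℚ.1/pos⇒pos B
    δ = ℚ.1/ B ℚ.* ε
    0<δ : 0ℚ ℚ.< δ
    0<δ = ℚ.positive⁻¹ δ {{ℚ.pos*pos⇒pos (ℚ.1/ B) ε}}
    eq : B ℚ.* δ ≡ ε
    eq = trans (sym (ℚ.*-assoc B (ℚ.1/ B) ε))
               (trans (cong (ℚ._* ε) (ℚ.*-inverseʳ B)) (ℚ.*-identityˡ ε))

  ∣*∣-mono : ∀ p q {B δ} → 0ℚ ℚ.< B → ℚ.∣ p ∣ ℚ.≤ B → ℚ.∣ q ∣ ℚ.< δ →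
             ℚ.∣ p ℚ.* q ∣ ℚ.< B ℚ.* δ
  ∣*∣-mono p q {B} {δ} 0<B p≤B q<δ = begin-strict
    ℚ.∣ p ℚ.* q ∣           ≡⟨ ℚ.∣p*q∣≡∣p∣*∣q∣ p q ⟩
    ℚ.∣ p ∣ ℚ.* ℚ.∣ q ∣     ≤⟨ ℚ.*-monoʳ-≤-nonNeg ℚ.∣ q ∣ {{ℚ.nonNegative (ℚ.0≤∣p∣ q)}} p≤B ⟩
    B ℚ.* ℚ.∣ q ∣           <⟨ ℚ.*-monoʳ-<-pos B {{ℚ.positive 0<B}} q<δ ⟩
    B ℚ.* δ                 ∎

  *-cauchy : ∀ x y → IsCauchy x → IsCauchy y → IsCauchy (λ i → x i ℚ.* y i)
  *-cauchy x y cx cy ε 0<ε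
    with bounded x cx | bounded y cy
  ... | B , 0<B , M , x≤B | C , 0<C , M′ , y≤C
    with shrink B 0<B (½ ℚ.* ε) (half 0<ε) | shrink C 0<C (½ ℚ.* ε) (half 0<ε)
  ... | δ , 0<δ , Bδ | η , 0<η , Cη
    with cy δ 0<δ | cx η 0<η
  ... | K , y<δ | K′ , x<η = (M ℕ.⊔ M′) ℕ.⊔ (K ℕ.⊔ K′) , bound
    where
    bound : ∀ i j → (M ℕ.⊔ M′) ℕ.⊔ (K ℕ.⊔ K′) ℕ.≤ i →
            (M ℕ.⊔ M′) ℕ.⊔ (K ℕ.⊔ K′) ℕ.≤ j →
            ℚ.∣ x i ℚ.* y i ℚ.- x j ℚ.* y j ∣ ℚ.< ε
    bound i j p q = begin-strict
      ℚ.∣ x i ℚ.* y i ℚ.- x j ℚ.* y j ∣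
        ≡⟨ cong ℚ.∣_∣ (product-minus (x i) (y i) (x j) (y j)) ⟩
      ℚ.∣ x i ℚ.* (y i ℚ.- y j) ℚ.+ y j ℚ.* (x i ℚ.- x j) ∣
        ≤⟨ ℚ.∣p+q∣≤∣p∣+∣q∣ (x i ℚ.* (y i ℚ.- y j)) (y j ℚ.* (x i ℚ.- x j)) ⟩
      ℚ.∣ x i ℚ.* (y i ℚ.- y j) ∣ ℚ.+ ℚ.∣ y j ℚ.* (x i ℚ.- x j) ∣
        <⟨ ℚ.+-mono-<
             (∣*∣-mono (x i) (y i ℚ.- y j) 0<B (x≤B i (M≤ p)) (y<δ i j (K≤ p) (K≤ q)))
             (∣*∣-mono (y j) (x i ℚ.- x j) 0<C (y≤C j (M′≤ q)) (x<η i j (K′≤ p) (K′≤ q))) ⟩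
      B ℚ.* δ ℚ.+ C ℚ.* η
        ≡⟨ cong₂ ℚ._+_ Bδ Cη ⟩
      ½ ℚ.* ε ℚ.+ ½ ℚ.* ε
        ≡⟨ halves ε ⟩
      ε ∎
      where
      module _ {l} (r : (M ℕ.⊔ M′) ℕ.⊔ (K ℕ.⊔ K′) ℕ.≤ l) where
        MM = ℕ.m⊔n≤o⇒m≤o (M ℕ.⊔ M′) (K ℕ.⊔ K′) r
        KK = ℕ.m⊔n≤o⇒n≤o (M ℕ.⊔ M′) (K ℕ.⊔ K′) r
        M≤  = ℕ.m⊔n≤o⇒m≤o M M′ MM
        M′≤ = ℕ.m⊔n≤o⇒n≤o M M′ MM
        K≤  = ℕ.m⊔n≤o⇒m≤o K K′ KK
        K′≤ = ℕ.m⊔n≤o⇒n≤o K K′ KK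

infixl 6 _+_ _-_
infixl 7 _*_
infix  8 -_

fromℚ : ℚ → ℝ
fromℚ q = mkℝ (λ _ → q) (const-cauchy q)

0ℝ 1ℝ : ℝ
0ℝ = fromℚ 0ℚ
1ℝ = fromℚ 1ℚ

_+_ _*_ : ℝ → ℝ → ℝ
x + y = mkℝ (λ i → seq x i ℚ.+ seq y i) (+-cauchy (seq x) (seq y) (cauchy x) (cauchy y))
x * y = mkℝ (λ i → seq x i ℚ.* seq y i) (*-cauchy (seq x) (seq y) (cauchy x) (cauchy y))

-_ : ℝ → ℝ
- x = mkℝ (λ i → ℚ.- seq x i) (neg-cauchy (seq x) (cauchy x))

_-_ : ℝ → ℝ → ℝ
x - y = x + (- y)

fromℤ : ℤ → ℚ
fromℤ z = z / 1

open RawMonoidOps ℕ.+-0-rawMonoid public using () renaming (sum to sumℕ)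
open RawMonoidOps ℤ.+-0-rawMonoid public using () renaming (sum to sumℤ)
open RawMonoidOps ℚ.+-0-rawMonoid public using () renaming (sum to sumℚ)

+-0-rawMonoid : RawMonoid 0ℓ 0ℓ
+-0-rawMonoid = record { Carrier = ℝ ; _≈_ = _≈_ ; _∙_ = _+_ ; ε = 0ℝ }

open RawMonoidOps +-0-rawMonoid public using () renaming (sum to sumℝ)

Matrix : Set → ℕ → ℕ → Set
Matrix X m n = Fin m → Fin n → X

LinearlyIndependent : Vector (Vector ℚ m) k → Set
LinearlyIndependent {m} {k} v =
  (c : Vector ℚ k) → (∀ (i : Fin m) → sumℚ (λ j → c j ℚ.* v j i) ≡ 0ℚ) → ∀ j → c j ≡ 0ℚ

columns : Matrix ℤ m n → Vector (Fin n) k → Vector (Vector ℚ m) k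
columns A J j i = fromℤ (A i (J j))

-- r is the largest number of linearly independent columns of A.  A family
-- in which a column is repeated is never independent.
HasRank : Matrix ℤ m n → ℕ → Set
HasRank {m} {n} A r =
  (∃[ J ] LinearlyIndependent {m} {r} (columns A J)) ×
  (∀ k (J : Vector (Fin n) k) → LinearlyIndependent (columns A J) → k ℕ.≤ r)

-- Laplace expansion along the first row.
det : Matrix ℤ n n → ℤ
det {zero}  B = 1ℤ
det {suc n} B = sumℤ λ j →
  (ℤ.-1ℤ ℤ.^ toℕ j) ℤ.* B zero j ℤ.* det (λ i l → B (suc i) (punchIn j l))

maximum : Vector ℕ n → ℕ
maximum = Vector.foldr ℕ._⊔_ 0

transpose : Matrix ℤ m n → Matrix ℤ n m
transpose B j i = B i j

∥_∥max ∥_∥₁ ∥_∥∞ : Matrix ℤ m n → ℕ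
∥ A ∥max = maximum λ i → maximum λ j → ℤ.∣ A i j ∣
-- ∥_∥₁ is the maximal row sum and ∥_∥∞ the maximal column sum: the opposite
-- of the convention for induced operator norms.
∥ B ∥₁ = maximum λ i → sumℕ λ j → ℤ.∣ B i j ∣
∥ B ∥∞ = maximum λ j → sumℕ λ i → ℤ.∣ B i j ∣

nonZeros : Vector ℤ n → ℕ
nonZeros v = List.length (filter (λ z → ¬? (z ℤ.≟ 0ℤ)) (toList v))

rs cs : Matrix ℤ m n → ℕ
rs B = maximum λ i → nonZeros (B i)
cs B = maximum λ j → nonZeros (transpose B j)

-- The k-element subsets of Fin n, each as its increasing enumeration.
subsets : ∀ k n → List (Vec (Fin n) k)
subsets zero    n       = Vec.[] ∷ []
subsets (suc k) zero    = []
subsets (suc k) (suc n) =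
  List.map (λ I → zero Vec.∷ Vec.map suc I) (subsets k n) ++
  List.map (Vec.map suc) (subsets (suc k) n)

submatrix : Matrix ℤ m n → Vec (Fin m) k → Vec (Fin n) k → Matrix ℤ k k
submatrix A I J i j = A (lookup I i) (lookup J j)

SquareMatrix : Set
SquareMatrix = ∃[ k ] Matrix ℤ k k

-- The empty 0 × 0 sub-matrix is included; all quantities maximised below
-- vanish on it.
squareSubmatrices : Matrix ℤ m n → List SquareMatrix
squareSubmatrices {m} {n} A = concatMap
  (λ k → cartesianProductWith (λ I J → k , submatrix A I J) (subsets k m) (subsets k n))
  (upTo (suc m))

nonDegenerate : Matrix ℤ m n → List SquareMatrix
nonDegenerate A = filter (λ (_ , B) → ¬? (det B ℤ.≟ 0ℤ)) (squareSubmatrices A)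

maxNonDegenerate : (∀ {k} → Matrix ℤ k k → ℕ) → Matrix ℤ m n → ℕ
maxNonDegenerate f A =
  List.foldr ℕ._⊔_ 0 (List.map (λ (_ , B) → f B) (nonDegenerate A))

γ₁ γ∞ γ₁,∞ : Matrix ℤ m n → ℕ
γ₁ = maxNonDegenerate ∥_∥₁
γ∞ = maxNonDegenerate ∥_∥∞
γ₁,∞ A = γ₁ A ℕ.⊓ γ∞ A

maxrs maxcs maxts : Matrix ℤ m n → ℕ
maxrs = maxNonDegenerate rs
maxcs = maxNonDegenerate cs
maxts A = maxrs A ℕ.⊓ maxcs A

infix 4 _≋_

_≋_ : Vector ℝ n → Vector ℝ n → Set
x ≋ y = ∀ j → x j ≈ y j

Polyhedron : Matrix ℤ m n → Vector ℚ m → Vector ℝ n → Set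
Polyhedron A b x =
  ∀ i → sumℝ (λ j → fromℚ (fromℤ (A i j)) * x j) ≤ fromℚ (b i)

-- Vertices are the extreme points: the points of P interior to no segment
-- between two distinct points of P.
IsVertex : (Vector ℝ n → Set) → Vector ℝ n → Set
IsVertex P x = P x × (∀ y z t → P y → P z → 0ℝ < t → t < 1ℝ →
  x ≋ (λ j → t * y j + (1ℝ - t) * z j) → y ≋ z)

-- The points satisfying Q, counted up to ≋, number at most N: every family
-- of pairwise distinct ones has at most N members.
AtMost : ℕ → (Vector ℝ n → Set) → Set
AtMost {n} N Q = ∀ k (v : Fin k → Vector ℝ n) →
  (∀ i → Q (v i)) → Injective _≡_ _≋_ v → k ℕ.≤ N

{-# OPTIONS --safe #-}

-- At a vertex v the constraints that are tight there contain n independent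
-- rows, say with indices I; otherwise the tight rows have an integer kernel
-- vector y ≠ 0 and v ± δy stay in P, so v is not extreme.  If z lies in the
-- open cone spanned by those rows, v is the only maximiser of z over P, so the
-- cones of different vertices are disjoint.  Instead of comparing volumes of
-- simplices (for γ₁) or parallelepipeds (for γ∞), one counts the integer points
-- Σ (sₖ + 1) aₖ, s ∈ ℕⁿ, ‖s‖ ≤ N, where ‖·‖ is the sum norm or the maximum norm:
-- they have norm at most γ(N + n).  Dividing their coordinates by γ with
-- remainder and recording signs embeds k copies of the ball B(N) of ℕⁿ into
-- (2γ)ⁿ copies of B(N + n).  If k > (2γ)ⁿ, then |B(N)| would grow exponentially,
-- but |B(N)| ≤ (N + 1)ⁿ.

module Submission where

open import Defs
open import Data.Integer.Base using (ℤ)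
open import Data.Nat.Base using (ℕ; _^_) renaming (_*_ to _*ℕ_; _≤_ to _≤ℕ_)
open import Data.Product.Base using (_×_)
open import Data.Rational.Base using (ℚ)
open import Data.Vec.Functional using (Vector)

open import Algebra.Bundles using (CommutativeRing)
import Algebra.Properties.Ring as RingProperties
import Algebra.Properties.Semiring.Sum as SemiringSum
open import Data.Empty using (⊥)
open import Data.Fin.Base using (Fin; zero; suc; toℕ; punchIn; pinch)
import Data.Fin.Properties as Fin
open import Data.Integer.Base as ℤ using (0ℤ; 1ℤ; -1ℤ)
import Data.Integer.Properties as ℤ
open import Data.Integer.Tactic.RingSolver using (solve-∀)
open import Data.List.Base as List
  using (List; length; upTo; filter; cartesianProduct; cartesianProductWith)
open import Data.List.Membership.Propositional using (_∈_)
open import Data.List.Membership.Propositional.Properties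
import Data.List.Properties as List
open import Data.List.Relation.Unary.All as All using ()
open import Data.List.Relation.Unary.AllPairs using ([]; _∷_)
open import Data.List.Relation.Unary.Any as Any using (here; there)
import Data.List.Relation.Unary.Any.Properties as Any
open import Data.List.Relation.Unary.Unique.Propositional using (Unique)
import Data.List.Relation.Unary.Unique.Propositional.Properties as Unique
open import Data.Nat.Base as ℕ using (zero; suc; z≤n; s≤s; NonZero)
open import Data.Nat.DivMod using (_%_; m%n<n; m≡m%n+[m/n]*n; m/n*n≤m)
  renaming (_/_ to _/ℕ_)
import Data.Nat.Properties as ℕ
open import Data.Nat.Tactic.RingSolver renaming (solve-∀ to solveℕ-∀) using ()
open import Data.Product.Base using (∃; ∃-syntax; _,_; proj₁; proj₂; uncurry)
open import Data.Rational.Base as ℚ using (0ℚ; 1ℚ; ½)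
import Data.Rational.Properties as ℚ
open import Data.Rational.Solver using (module +-*-Solver)
import Data.Rational.Unnormalised.Base as ℚᵘ
import Data.Rational.Unnormalised.Properties as ℚᵘ
open import Data.Sum.Base as Sum using (_⊎_; inj₁; inj₂; [_,_]′)
open import Data.Vec.Base as Vec using (Vec; []; _∷_; lookup)
import Data.Vec.Functional as Vector
import Data.Vec.Properties as Vec
open import Function.Base using (_∘_)
open import Function.Definitions using (Injective)
open import Level using (0ℓ)
open import Relation.Binary.PropositionalEquality
open import Relation.Nullary.Decidable
  using (Dec; yes; no; ¬?; _×-dec_; decidable-stable; ¬¬-excluded-middle; toSum)
open import Relation.Nullary.Negation using (¬_; contradiction)
open import Relation.Unary using (Pred; Decidable)

-- The reals are Cauchy sequences, so it cannot be decided whether a constraint is tight at a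
-- vertex. The geometry is therefore done under a double negation, removed at the very end because
-- `k ≤ N` is a decidable comparison of natural numbers. Points of the polyhedron enter only through
-- termwise rational identities and limits; the linear algebra is over the integers, where vanishing
-- is decidable.
--
-- The transposed basis matrix sends coefficients to points of the cone. It multiplies the sum norm
-- by at most the largest row sum and the maximum norm by at most the largest column sum, which
-- pairs these norms with γ₁ and γ∞. Enlarging the radius by the constant n cannot offset a
-- multiplication of the count by a fixed factor above 1, so a crude polynomial bound on the balls
-- suffices and no volume has to be known. Division by γ needs γ ≠ 0, which a basis provides once n
-- ≥ 1; n = 0 is treated apart.

private
  module Σℕ = SemiringSum ℕ.+-*-semiring
  module Σℤ = SemiringSum ℤ.+-*-semiring
  module Σℚ = SemiringSum (CommutativeRing.semiring ℚ.+-*-commutativeRing)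
  module ℚ± = RingProperties ℚ.+-*-ring

  variable
    m n k : ℕ

-- Determinants

sign : Fin n → ℤ
sign j = -1ℤ ℤ.^ toℕ j

-- A pair `j`, `l` codes the ordered pair of distinct columns `j` and `punchIn j l`; the reindexing
-- exchanges the two. In the induction, row zero and column zero of `F` change places.
sum-swap : (F : Fin (suc n) → Fin n → ℤ) →
  sumℤ (λ j → sumℤ (F j)) ≡ sumℤ (λ j → sumℤ (λ l → F (punchIn j l) (pinch l j)))
sum-swap {zero}  F = refl
sum-swap {suc n} F = begin
  sumℤ (F zero) ℤ.+ sumℤ (λ j → F (suc j) zero ℤ.+ sumℤ (λ l → F (suc j) (suc l)))
    ≡⟨ cong (λ z → sumℤ (F zero) ℤ.+ z) (Σℤ.∑-distrib-+ (λ j → F (suc j) zero) (λ j → sumℤ (λ l → F (suc j) (suc l)))) ⟩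
  sumℤ (F zero) ℤ.+ (sumℤ (λ j → F (suc j) zero) ℤ.+ sumℤ (λ j → sumℤ (λ l → F (suc j) (suc l))))
    ≡⟨ cong (λ z → sumℤ (F zero) ℤ.+ (sumℤ (λ j → F (suc j) zero) ℤ.+ z))
         (sum-swap (λ j l → F (suc j) (suc l))) ⟩
  sumℤ (F zero) ℤ.+ (sumℤ (λ j → F (suc j) zero) ℤ.+ R)
    ≡⟨ rotate (sumℤ (F zero)) (sumℤ (λ j → F (suc j) zero)) R ⟩
  sumℤ (λ j → F (suc j) zero) ℤ.+ (sumℤ (F zero) ℤ.+ R)
    ≡⟨ cong (λ z → sumℤ (λ j → F (suc j) zero) ℤ.+ z) (Σℤ.∑-distrib-+ (F zero) (λ j → sumℤ (λ l → F (suc (punchIn j l)) (suc (pinch l j))))) ⟨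
  _ ∎
  where
  open ≡-Reasoning
  R = sumℤ (λ j → sumℤ (λ l → F (suc (punchIn j l)) (suc (pinch l j))))
  rotate : ∀ a b c → a ℤ.+ (b ℤ.+ c) ≡ b ℤ.+ (a ℤ.+ c)
  rotate = solve-∀

-- Both sides enumerate the columns that remain when the same two are deleted, in either order;
-- hence the two expansions share their minors.
punchIn-swap : ∀ (j : Fin (suc (suc n))) l x →
  punchIn (punchIn j l) (punchIn (pinch l j) x) ≡ punchIn j (punchIn l x)
punchIn-swap zero    l       x       = refl
punchIn-swap (suc j) zero    x       = refl
punchIn-swap {suc n} (suc j) (suc l) zero    = refl
punchIn-swap {suc n} (suc j) (suc l) (suc x) = cong suc (punchIn-swap j l x)

punchIn-pinch : ∀ (j : Fin (suc n)) l → punchIn (punchIn j l) (pinch l j) ≡ j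
punchIn-pinch zero    zero    = refl
punchIn-pinch zero    (suc l) = refl
punchIn-pinch (suc j) zero    = refl
punchIn-pinch (suc j) (suc l) = cong suc (punchIn-pinch j l)

-- Deleting the first column shifts the position of the second exactly when the second lies to its
-- right. This happens in one of the two orders only, so the exponents differ in parity.
sign-swap : ∀ (j : Fin (suc n)) l →
  sign j ℤ.* sign l ≡ ℤ.- (sign (punchIn j l) ℤ.* sign (pinch l j))
sign-swap zero    zero    = refl
sign-swap zero    (suc l) = lemma (sign l)
  where
  lemma : ∀ a → 1ℤ ℤ.* (-1ℤ ℤ.* a) ≡ ℤ.- ((-1ℤ ℤ.* (-1ℤ ℤ.* a)) ℤ.* 1ℤ)
  lemma = solve-∀
sign-swap (suc j) zero    = lemma (sign j)
  where
  lemma : ∀ a → (-1ℤ ℤ.* a) ℤ.* 1ℤ ≡ ℤ.- (1ℤ ℤ.* a)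
  lemma = solve-∀
sign-swap (suc j) (suc l) =
  trans (lemma (sign j) (sign l))
    (trans (sign-swap j l) (cong ℤ.-_ (sym (lemma (sign (punchIn j l)) (sign (pinch l j))))))
  where
  lemma : ∀ a b → (-1ℤ ℤ.* a) ℤ.* (-1ℤ ℤ.* b) ≡ a ℤ.* b
  lemma = solve-∀

det-cong : (B C : Matrix ℤ n n) → (∀ i j → B i j ≡ C i j) → det B ≡ det C
det-cong {zero}  B C B≗C = refl
det-cong {suc n} B C B≗C = Σℤ.sum-cong-≗ λ j →
  cong₂ ℤ._*_ (cong (sign j ℤ.*_) (B≗C zero j)) (det-cong _ _ λ i l → B≗C (suc i) (punchIn j l))

-- Expanding along the first two rows gives a sum over ordered pairs of distinct columns. Exchanging
-- the columns of a pair keeps the minor and flips the sign.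
det-swap : ∀ (x y : Vector ℤ (suc (suc n))) (B : Matrix ℤ n (suc (suc n))) →
  det (x Vector.∷ y Vector.∷ B) ≡ ℤ.- det (y Vector.∷ x Vector.∷ B)
det-swap {n} x y B = begin
  det (x Vector.∷ y Vector.∷ B)
    ≡⟨ expand x y ⟩
  sumℤ (λ j → sumℤ (λ l → term x y j l))
    ≡⟨ Σℤ.sum-cong-≗ (λ j → Σℤ.sum-cong-≗ (λ l → term-swap j l)) ⟩
  sumℤ (λ j → sumℤ (λ l → -1ℤ ℤ.* term y x (punchIn j l) (pinch l j)))
    ≡⟨ Σℤ.sum-cong-≗ (λ j → Σℤ.*-distribˡ-sum -1ℤ (λ l → term y x (punchIn j l) (pinch l j))) ⟨
  sumℤ (λ j → -1ℤ ℤ.* sumℤ (λ l → term y x (punchIn j l) (pinch l j)))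
    ≡⟨ Σℤ.*-distribˡ-sum -1ℤ (λ j → sumℤ (λ l → term y x (punchIn j l) (pinch l j))) ⟨
  -1ℤ ℤ.* sumℤ (λ j → sumℤ (λ l → term y x (punchIn j l) (pinch l j)))
    ≡⟨ cong (-1ℤ ℤ.*_) (sum-swap (term y x)) ⟨
  -1ℤ ℤ.* sumℤ (λ j → sumℤ (term y x j))
    ≡⟨ cong (-1ℤ ℤ.*_) (expand y x) ⟨
  -1ℤ ℤ.* det (y Vector.∷ x Vector.∷ B)
    ≡⟨ ℤ.-1*i≡-i _ ⟩
  ℤ.- det (y Vector.∷ x Vector.∷ B) ∎
  where
  open ≡-Reasoning
  minor : Fin (suc (suc n)) → Fin (suc n) → ℤ
  minor j l = det (λ i t → B i (punchIn j (punchIn l t)))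
  term : (u v : Vector ℤ (suc (suc n))) → Fin (suc (suc n)) → Fin (suc n) → ℤ
  term u v j l = sign j ℤ.* u j ℤ.* (sign l ℤ.* v (punchIn j l) ℤ.* minor j l)
  expand : ∀ u v → det (u Vector.∷ v Vector.∷ B) ≡ sumℤ (λ j → sumℤ (term u v j))
  expand u v = Σℤ.sum-cong-≗ λ j → Σℤ.*-distribˡ-sum (sign j ℤ.* u j)
    (λ l → sign l ℤ.* v (punchIn j l) ℤ.* minor j l)
  regroup : ∀ a b c d e → a ℤ.* b ℤ.* (c ℤ.* d ℤ.* e) ≡ (a ℤ.* c) ℤ.* (b ℤ.* d ℤ.* e)
  regroup = solve-∀
  regroup′ : ∀ a b c d e →
    ℤ.- (a ℤ.* c) ℤ.* (b ℤ.* d ℤ.* e) ≡ -1ℤ ℤ.* (a ℤ.* d ℤ.* (c ℤ.* b ℤ.* e))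
  regroup′ = solve-∀
  term-swap : ∀ j l → term x y j l ≡ -1ℤ ℤ.* term y x (punchIn j l) (pinch l j)
  term-swap j l = begin
    term x y j l
      ≡⟨ regroup (sign j) (x j) (sign l) (y (punchIn j l)) (minor j l) ⟩
    (sign j ℤ.* sign l) ℤ.* (x j ℤ.* y (punchIn j l) ℤ.* minor j l)
      ≡⟨ cong₂ ℤ._*_ (sign-swap j l)
           (cong₂ (λ a b → a ℤ.* y (punchIn j l) ℤ.* b)
             (cong x (sym (punchIn-pinch j l)))
             (det-cong _ _ (λ i t → cong (B i) (sym (punchIn-swap j l t))))) ⟩
    ℤ.- (sign j′ ℤ.* sign l′) ℤ.* (x (punchIn j′ l′) ℤ.* y j′ ℤ.* minor j′ l′)
      ≡⟨ regroup′ (sign j′) (x (punchIn j′ l′)) (sign l′) (y j′) (minor j′ l′) ⟩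
    -1ℤ ℤ.* term y x j′ l′ ∎
    where
    j′ = punchIn j l
    l′ = pinch l j

i≡-i⇒i≡0 : ∀ i → i ≡ ℤ.- i → i ≡ 0ℤ
i≡-i⇒i≡0 (ℤ.+ zero)   _ = refl
i≡-i⇒i≡0 ℤ.+[1+ n ]   ()
i≡-i⇒i≡0 (ℤ.-[1+ n ]) ()

-- If the copy sits directly below, swapping the two rows gives a determinant equal to its own
-- negative. Otherwise a swap moves the copy below the first row, and every minor of the expansion
-- along that row again has a repeated row.
det-repeat : ∀ (B : Matrix ℤ n (suc n)) k → det (B k Vector.∷ B) ≡ 0ℤ
det-repeat {suc n} B zero    = i≡-i⇒i≡0 _ (det-swap (B zero) (B zero) (B ∘ suc))
det-repeat {suc n} B (suc k) = begin
  det (B (suc k) Vector.∷ B)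
    ≡⟨ det-swap (B (suc k)) (B zero) (B ∘ suc) ⟩
  ℤ.- det (B zero Vector.∷ B (suc k) Vector.∷ B ∘ suc)
    ≡⟨ cong ℤ.-_ (Σℤ.sum-cong-≗ (λ j → trans
         (cong (sign j ℤ.* B zero j ℤ.*_)
           (trans (det-cong (λ i l → (B zero Vector.∷ B (suc k) Vector.∷ B ∘ suc) (suc i) (punchIn j l))
               ((λ l → B (suc k) (punchIn j l)) Vector.∷ λ i l → B (suc i) (punchIn j l))
               (λ { zero l → refl ; (suc i) l → refl }))
             (det-repeat (λ i l → B (suc i) (punchIn j l)) k)))
         (ℤ.*-zeroʳ (sign j ℤ.* B zero j)))) ⟩
  ℤ.- sumℤ {suc (suc n)} (λ _ → 0ℤ)
    ≡⟨ cong ℤ.-_ (Σℤ.sum-replicate-zero (suc (suc n))) ⟩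
  0ℤ ∎
  where open ≡-Reasoning

-- Reordering of row selections

infix 4 _∼_

-- Permutations generated by adjacent transpositions, so that `det-swap` alone governs their effect
-- on determinants.
data _∼_ {X : Set} : Vec X k → Vec X k → Set where
  refl∼  : ∀ {I : Vec X k} → I ∼ I
  prep∼  : ∀ {x} {I J : Vec X k} → I ∼ J → x ∷ I ∼ x ∷ J
  swap∼  : ∀ {x y} {I : Vec X k} → x ∷ y ∷ I ∼ y ∷ x ∷ I
  trans∼ : ∀ {I J K : Vec X k} → I ∼ J → J ∼ K → I ∼ K

det-rows : Matrix ℤ m k → Vec (Fin m) k → ℤ
det-rows A I = det (λ i j → A (lookup I i) j)

-- The factor `e` must not depend on `A`: under `prep∼` the induction hypothesis is applied to all
-- minors of the expansion at once, and the common factor is then pulled out of the sum.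
det-∼ : {I J : Vec (Fin m) k} → I ∼ J →
  ∃[ e ] ∀ (A : Matrix ℤ m k) → det-rows A I ≡ e ℤ.* det-rows A J
det-∼ refl∼ = 1ℤ , λ A → sym (ℤ.*-identityˡ _)
det-∼ {I = x ∷ I} {x ∷ J} (prep∼ I∼J) with e , eq ← det-∼ I∼J = e , λ A → trans
  (Σℤ.sum-cong-≗ λ j → trans
    (cong (sign j ℤ.* A x j ℤ.*_) (eq (λ i l → A i (punchIn j l))))
    (pull (sign j ℤ.* A x j) e _))
  (sym (Σℤ.*-distribˡ-sum e (λ j → sign j ℤ.* A x j ℤ.* det-rows (λ i l → A i (punchIn j l)) J)))
  where
  pull : ∀ a b c → a ℤ.* (b ℤ.* c) ≡ b ℤ.* (a ℤ.* c)
  pull = solve-∀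
det-∼ {I = x ∷ y ∷ I} swap∼ = -1ℤ , λ A →
  trans (det-swap (A x) (A y) (λ i → A (lookup I i))) (sym (ℤ.-1*i≡-i _))
det-∼ (trans∼ p q) with e , eq ← det-∼ p | f , eq′ ← det-∼ q = e ℤ.* f , λ A →
  trans (eq A) (trans (cong (e ℤ.*_) (eq′ A)) (sym (ℤ.*-assoc e f _)))

-- Rational sequences with nonnegative lower limit, and null sequences

toℚᵘ-fromℤ : ∀ z → ℚ.toℚᵘ (fromℤ z) ℚᵘ.≃ ℚᵘ.mkℚᵘ z 0
toℚᵘ-fromℤ z = ℚ.toℚᵘ-fromℚᵘ (ℚᵘ.mkℚᵘ z 0)

fromℤ-+ : ∀ a b → fromℤ (a ℤ.+ b) ≡ fromℤ a ℚ.+ fromℤ b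
fromℤ-+ a b = ℚ.toℚᵘ-injective (begin
  ℚ.toℚᵘ (fromℤ (a ℤ.+ b))                    ≈⟨ toℚᵘ-fromℤ (a ℤ.+ b) ⟩
  ℚᵘ.mkℚᵘ (a ℤ.+ b) 0                         ≈⟨ ℚᵘ.*≡* (lemma a b) ⟩
  ℚᵘ.mkℚᵘ a 0 ℚᵘ.+ ℚᵘ.mkℚᵘ b 0                ≈⟨ ℚᵘ.+-cong (toℚᵘ-fromℤ a) (toℚᵘ-fromℤ b) ⟨
  ℚ.toℚᵘ (fromℤ a) ℚᵘ.+ ℚ.toℚᵘ (fromℤ b)      ≈⟨ ℚ.toℚᵘ-homo-+ (fromℤ a) (fromℤ b) ⟨
  ℚ.toℚᵘ (fromℤ a ℚ.+ fromℤ b)                ∎)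
  where
  open ℚᵘ.≃-Reasoning
  lemma : ∀ a b → (a ℤ.+ b) ℤ.* 1ℤ ≡ (a ℤ.* 1ℤ ℤ.+ b ℤ.* 1ℤ) ℤ.* 1ℤ
  lemma = solve-∀

fromℤ-* : ∀ a b → fromℤ (a ℤ.* b) ≡ fromℤ a ℚ.* fromℤ b
fromℤ-* a b = ℚ.toℚᵘ-injective (begin
  ℚ.toℚᵘ (fromℤ (a ℤ.* b))                    ≈⟨ toℚᵘ-fromℤ (a ℤ.* b) ⟩
  ℚᵘ.mkℚᵘ a 0 ℚᵘ.* ℚᵘ.mkℚᵘ b 0                ≈⟨ ℚᵘ.*-cong (toℚᵘ-fromℤ a) (toℚᵘ-fromℤ b) ⟨
  ℚ.toℚᵘ (fromℤ a) ℚᵘ.* ℚ.toℚᵘ (fromℤ b)      ≈⟨ ℚ.toℚᵘ-homo-* (fromℤ a) (fromℤ b) ⟨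
  ℚ.toℚᵘ (fromℤ a ℚ.* fromℤ b)                ∎)
  where open ℚᵘ.≃-Reasoning

fromℤ-neg : ∀ a → fromℤ (ℤ.- a) ≡ ℚ.- fromℤ a
fromℤ-neg a = ℚ.toℚᵘ-injective (begin
  ℚ.toℚᵘ (fromℤ (ℤ.- a))      ≈⟨ toℚᵘ-fromℤ (ℤ.- a) ⟩
  ℚᵘ.- ℚᵘ.mkℚᵘ a 0            ≈⟨ ℚᵘ.-‿cong (toℚᵘ-fromℤ a) ⟨
  ℚᵘ.- ℚ.toℚᵘ (fromℤ a)       ≈⟨ ℚ.toℚᵘ-homo‿- (fromℤ a) ⟨
  ℚ.toℚᵘ (ℚ.- fromℤ a)        ∎)
  where open ℚᵘ.≃-Reasoning

fromℤ-injective : ∀ {a b} → fromℤ a ≡ fromℤ b → a ≡ b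
fromℤ-injective {a} {b} eq with ℚᵘ.≃-trans (ℚᵘ.≃-sym (toℚᵘ-fromℤ a)) (ℚᵘ.≃-trans (ℚᵘ.≃-reflexive (cong ℚ.toℚᵘ eq)) (toℚᵘ-fromℤ b))
... | ℚᵘ.*≡* eq′ = trans (sym (ℤ.*-identityʳ a)) (trans eq′ (ℤ.*-identityʳ b))

fromℤ-mono-≤ : ∀ {a b} → a ℤ.≤ b → fromℤ a ℚ.≤ fromℤ b
fromℤ-mono-≤ {a} {b} a≤b = ℚ.toℚᵘ-cancel-≤ (ℚᵘ.≤-respˡ-≃ (ℚᵘ.≃-sym (toℚᵘ-fromℤ a))
  (ℚᵘ.≤-respʳ-≃ (ℚᵘ.≃-sym (toℚᵘ-fromℤ b))
    (ℚᵘ.*≤* (subst₂ ℤ._≤_ (sym (ℤ.*-identityʳ a)) (sym (ℤ.*-identityʳ b)) a≤b))))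

fromℤ-sum : (f : Vector ℤ n) → fromℤ (sumℤ f) ≡ sumℚ (fromℤ ∘ f)
fromℤ-sum {zero}  f = refl
fromℤ-sum {suc n} f = trans (fromℤ-+ (f zero) (sumℤ (f ∘ suc))) (cong (λ q → fromℤ (f zero) ℚ.+ q) (fromℤ-sum (f ∘ suc)))

-- The lower limit of x is at least 0.
record Nonneg (x : ℕ → ℚ) : Set where
  constructor mkNonneg
  field
    eventually : ∀ ε → 0ℚ ℚ.< ε → ∃[ N ] ∀ s → N ℕ.≤ s → 0ℚ ℚ.≤ x s ℚ.+ ε

open Nonneg

Null : (ℕ → ℚ) → Set
Null x = Nonneg x × Nonneg (λ s → ℚ.- x s)

half-pos : ∀ {ε} → 0ℚ ℚ.< ε → 0ℚ ℚ.< ½ ℚ.* ε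
half-pos {ε} 0<ε = ℚ.positive⁻¹ (½ ℚ.* ε) {{ℚ.pos*pos⇒pos ½ ε {{ℚ.positive 0<ε}}}}

½+½ : ∀ ε → ½ ℚ.* ε ℚ.+ ½ ℚ.* ε ≡ ε
½+½ ε = trans (sym (ℚ.*-distribʳ-+ ε ½ ½)) (ℚ.*-identityˡ ε)

nonneg-cong : ∀ {x y : ℕ → ℚ} → (∀ s → x s ≡ y s) → Nonneg x → Nonneg y
nonneg-cong x≗y x≥0 .eventually ε 0<ε with N , p ← eventually x≥0 ε 0<ε =
  N , λ s N≤s → subst (λ q → 0ℚ ℚ.≤ q ℚ.+ ε) (x≗y s) (p s N≤s)

nonneg-0 : Nonneg (λ _ → 0ℚ)
nonneg-0 .eventually ε 0<ε = 0 , λ _ _ → ℚ.≤-trans (ℚ.<⇒≤ 0<ε) (ℚ.≤-reflexive (sym (ℚ.+-identityˡ ε)))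

nonneg-+ : ∀ {x y : ℕ → ℚ} → Nonneg x → Nonneg y → Nonneg (λ s → x s ℚ.+ y s)
nonneg-+ {x} {y} x≥0 y≥0 .eventually ε 0<ε with eventually x≥0 (½ ℚ.* ε) (half-pos 0<ε) | eventually y≥0 (½ ℚ.* ε) (half-pos 0<ε)
... | N , p | M , q = N ℕ.⊔ M , λ s le → ℚ.≤-trans
  (ℚ.+-mono-≤ (p s (ℕ.m⊔n≤o⇒m≤o N M le)) (q s (ℕ.m⊔n≤o⇒n≤o N M le)))
  (ℚ.≤-reflexive (trans (lemma (x s) (½ ℚ.* ε) (y s)) (cong (λ q → x s ℚ.+ y s ℚ.+ q) (½+½ ε))))
  where
  open +-*-Solver
  lemma : ∀ a h b → (a ℚ.+ h) ℚ.+ (b ℚ.+ h) ≡ (a ℚ.+ b) ℚ.+ (h ℚ.+ h)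
  lemma = solve 3 (λ a h b → (a :+ h) :+ (b :+ h) := (a :+ b) :+ (h :+ h)) refl

-- By repeated addition, so that no ε has to be divided by `t`.
nonneg-ℕ* : ∀ {x : ℕ → ℚ} t → Nonneg x → Nonneg (λ s → fromℤ (ℤ.+ t) ℚ.* x s)
nonneg-ℕ* {x} zero    x≥0 = nonneg-cong (λ s → sym (ℚ.*-zeroˡ (x s))) nonneg-0
nonneg-ℕ* {x} (suc t) x≥0 = nonneg-cong
  (λ s → sym (trans (cong (ℚ._* x s) (fromℤ-+ 1ℤ (ℤ.+ t)))
    (trans (ℚ.*-distribʳ-+ (x s) 1ℚ (fromℤ (ℤ.+ t)))
      (cong (ℚ._+ fromℤ (ℤ.+ t) ℚ.* x s) (ℚ.*-identityˡ (x s))))))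
  (nonneg-+ x≥0 (nonneg-ℕ* t x≥0))

-- The same threshold works: a term that is at least 0 needs no argument, and a term below 0 only
-- decreases when multiplied by `suc t`.
nonneg-cancel : ∀ {x : ℕ → ℚ} t → Nonneg (λ s → fromℤ (ℤ.+ suc t) ℚ.* x s) → Nonneg x
nonneg-cancel {x} t x≥0 .eventually ε 0<ε with N , p ← eventually x≥0 ε 0<ε = N , bound
  where
  bound : ∀ s → N ℕ.≤ s → 0ℚ ℚ.≤ x s ℚ.+ ε
  bound s N≤s with ℚ.≤-total 0ℚ (x s)
  ... | inj₁ 0≤x = ℚ.+-mono-≤ 0≤x (ℚ.<⇒≤ 0<ε)
  ... | inj₂ x≤0 = ℚ.≤-trans (p s N≤s) (ℚ.+-monoˡ-≤ ε (begin
    fromℤ (ℤ.+ suc t) ℚ.* x s ≤⟨ ℚ.*-monoʳ-≤-nonPos (x s) {{ℚ.nonPositive x≤0}} (fromℤ-mono-≤ {1ℤ} {ℤ.+ suc t} (ℤ.+≤+ (ℕ.s≤s ℕ.z≤n))) ⟩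
    1ℚ ℚ.* x s ≡⟨ ℚ.*-identityˡ (x s) ⟩
    x s ∎))
    where open ℚ.≤-Reasoning

null-cong : ∀ {x y : ℕ → ℚ} → (∀ s → x s ≡ y s) → Null x → Null y
null-cong x≗y (p , q) = nonneg-cong x≗y p , nonneg-cong (λ s → cong ℚ.-_ (x≗y s)) q

null-0 : Null (λ _ → 0ℚ)
null-0 = nonneg-0 , nonneg-0

null-+ : ∀ {x y : ℕ → ℚ} → Null x → Null y → Null (λ s → x s ℚ.+ y s)
null-+ {x} {y} (p , q) (p′ , q′) = nonneg-+ p p′ ,
  nonneg-cong (λ s → sym (ℚ.neg-distrib-+ (x s) (y s))) (nonneg-+ q q′)

null-neg : ∀ {x : ℕ → ℚ} → Null x → Null (λ s → ℚ.- x s)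
null-neg {x} (p , q) = q , nonneg-cong (λ s → sym (ℚ±.-‿involutive (x s))) p

neg-scale : ∀ c q → fromℤ (ℤ.- c) ℚ.* q ≡ ℚ.- (fromℤ c ℚ.* q)
neg-scale c q = trans (cong (ℚ._* q) (fromℤ-neg c)) (sym (ℚ.neg-distribˡ-* (fromℤ c) q))

scale-neg : ∀ c q → fromℤ c ℚ.* (ℚ.- q) ≡ ℚ.- (fromℤ c ℚ.* q)
scale-neg c q = sym (ℚ.neg-distribʳ-* (fromℤ c) q)

null-* : ∀ {x : ℕ → ℚ} c → Null x → Null (λ s → fromℤ c ℚ.* x s)
null-* {x} (ℤ.+ t)    (p , q) = nonneg-ℕ* t p , nonneg-cong (λ s → scale-neg (ℤ.+ t) (x s)) (nonneg-ℕ* t q)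
null-* {x} (ℤ.-[1+ t ]) null  =
  null-cong (λ s → sym (neg-scale (ℤ.+ suc t) (x s))) (null-neg (null-* (ℤ.+ suc t) null))

null-cancel : ∀ {x : ℕ → ℚ} c → c ≢ 0ℤ → Null (λ s → fromℤ c ℚ.* x s) → Null x
null-cancel ℤ.+0       c≢0 _ = contradiction refl c≢0
null-cancel {x} ℤ.+[1+ t ] _ (p , q) =
  nonneg-cancel t p , nonneg-cancel t (nonneg-cong (λ s → sym (scale-neg ℤ.+[1+ t ] (x s))) q)
null-cancel {x} (ℤ.-[1+ t ]) _ null = null-cancel ℤ.+[1+ t ] (λ ())
  (null-cong (λ s → trans (cong ℚ.-_ (neg-scale ℤ.+[1+ t ] (x s))) (ℚ±.-‿involutive _)) (null-neg null))

null-sum : ∀ (f : Fin n → ℕ → ℚ) → (∀ j → Null (f j)) → Null (λ s → sumℚ (λ j → f j s))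
null-sum {zero}  f null = null-0
null-sum {suc n} f null = null-+ (null zero) (null-sum (f ∘ suc) (null ∘ suc))

-- Bases among the rows of a matrix

infix 8 _·_

_·_ : Vector ℤ n → Vector ℚ n → ℚ
a · x = sumℚ λ j → fromℤ (a j) ℚ.* x j

dot-combine : ∀ (r : Vector ℤ n) (x y : Vector ℚ n) a b →
  r · (λ j → a ℚ.* x j ℚ.- y j ℚ.* b) ≡ a ℚ.* r · x ℚ.- (r · y) ℚ.* b
dot-combine {zero}  r x y a b = sym (trans (cong₂ ℚ._-_ (ℚ.*-zeroʳ a) (ℚ.*-zeroˡ b)) refl)
dot-combine {suc n} r x y a b =
  trans (cong (λ q → fromℤ (r zero) ℚ.* (a ℚ.* x zero ℚ.- y zero ℚ.* b) ℚ.+ q) (dot-combine (r ∘ suc) (x ∘ suc) (y ∘ suc) a b))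
    (lemma (fromℤ (r zero)) a (x zero) (y zero) b ((r ∘ suc) · (x ∘ suc)) ((r ∘ suc) · (y ∘ suc)))
  where
  open +-*-Solver
  lemma : ∀ r a x y b p q →
    r ℚ.* (a ℚ.* x ℚ.- y ℚ.* b) ℚ.+ (a ℚ.* p ℚ.- q ℚ.* b) ≡ a ℚ.* (r ℚ.* x ℚ.+ p) ℚ.- (r ℚ.* y ℚ.+ q) ℚ.* b
  lemma = solve 7 (λ r a x y b p q →
    r :* (a :* x :- y :* b) :+ (a :* p :- q :* b) := a :* (r :* x :+ p) :- (r :* y :+ q) :* b) refl

dot-fromℤ : ∀ (r y : Vector ℤ n) → r · (fromℤ ∘ y) ≡ fromℤ (sumℤ (λ j → r j ℤ.* y j))
dot-fromℤ r y = trans (Σℚ.sum-cong-≗ (λ j → sym (fromℤ-* (r j) (y j)))) (sym (fromℤ-sum (λ j → r j ℤ.* y j)))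

-- Three faces of invertibility, proved together by adding one row and one column at a time, so that
-- no inverse matrix is formed. `det≢0` gives access to γ₁ and γ∞, `independent` makes the
-- coefficients of a cone point unique, and `separating` identifies two points on which the rows of
-- `I` agree in the limit.
record Basis (A : Matrix ℤ m n) (I : Vec (Fin m) n) : Set where
  field
    det≢0       : det-rows A I ≢ 0ℤ
    independent : ∀ (c : Vector ℤ n) → (∀ j → sumℤ (λ k → c k ℤ.* A (lookup I k) j) ≡ 0ℤ) →
                  ∀ k → c k ≡ 0ℤ
    separating  : ∀ (x : Fin n → ℕ → ℚ) → (∀ k → Null (λ s → A (lookup I k) · (λ j → x j s))) →
                  ∀ j → Null (x j)

module Extend (A : Matrix ℤ m (suc n)) (I : Vec (Fin m) n)
  (basis : Basis (λ i j → A i (suc j)) I) where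

  open Basis basis

  -- The generalised cross product of the `n` rows of `I` in dimension `suc n`. Its coordinate zero
  -- is the determinant of the given smaller basis, hence not 0.
  cofactor : Vector ℤ (suc n)
  cofactor j = sign j ℤ.* det (λ k l → A (lookup I k) (punchIn j l))

  det≡dot : ∀ (r : Vector ℤ (suc n)) →
    sumℤ (λ j → r j ℤ.* cofactor j) ≡ det (r Vector.∷ λ k → A (lookup I k))
  det≡dot r = Σℤ.sum-cong-≗ λ j →
    lemma (r j) (sign j) (det (λ k l → A (lookup I k) (punchIn j l)))
    where
    lemma : ∀ a b c → a ℤ.* (b ℤ.* c) ≡ b ℤ.* a ℤ.* c
    lemma = solve-∀

  orthogonal : ∀ k → sumℤ (λ j → A (lookup I k) j ℤ.* cofactor j) ≡ 0ℤ
  orthogonal k = trans (det≡dot (A (lookup I k))) (det-repeat (λ k → A (lookup I k)) k)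

  cofactor₀≢0 : cofactor zero ≢ 0ℤ
  cofactor₀≢0 eq = det≢0 (trans (sym (ℤ.*-identityˡ _)) eq)

  module _ (i : Fin m) (Δ≢0 : sumℤ (λ j → A i j ℤ.* cofactor j) ≢ 0ℤ) where

    private Δ = sumℤ (λ j → A i j ℤ.* cofactor j)

    extended : Basis A (i ∷ I)
    extended = record { det≢0 = det≢0′ ; independent = independent′ ; separating = separating′ }
      where
      det≢0′ : det-rows A (i ∷ I) ≢ 0ℤ
      det≢0′ eq = Δ≢0 (trans (det≡dot (A i)) eq)

      independent′ : ∀ (c : Vector ℤ (suc n)) →
        (∀ j → sumℤ (λ k → c k ℤ.* A (lookup (i ∷ I) k) j) ≡ 0ℤ) → ∀ k → c k ≡ 0ℤ
      independent′ c rel = λ { zero → c₀≡0 ; (suc k) → independent (c ∘ suc) rel′ k }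
        where
        open ≡-Reasoning
        B : Matrix ℤ (suc n) (suc n)
        B k = A (lookup (i ∷ I) k)
        -- Pairing the relation with `cofactor` kills all rows of `I` and leaves the new row alone.
        cΔ≡0 : c zero ℤ.* Δ ≡ 0ℤ
        cΔ≡0 = begin
          c zero ℤ.* Δ
            ≡⟨ ℤ.+-identityʳ _ ⟨
          c zero ℤ.* Δ ℤ.+ 0ℤ
            ≡⟨ cong (λ z → c zero ℤ.* Δ ℤ.+ z) (trans (Σℤ.sum-cong-≗ {n} (λ k → trans (cong (c (suc k) ℤ.*_) (orthogonal k)) (ℤ.*-zeroʳ (c (suc k))))) (Σℤ.sum-replicate-zero n)) ⟨
          sumℤ (λ k → c k ℤ.* sumℤ (λ j → B k j ℤ.* cofactor j))
            ≡⟨ Σℤ.sum-cong-≗ (λ k → Σℤ.*-distribˡ-sum (c k) (λ j → B k j ℤ.* cofactor j)) ⟩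
          sumℤ (λ k → sumℤ (λ j → c k ℤ.* (B k j ℤ.* cofactor j)))
            ≡⟨ Σℤ.∑-comm (λ k j → c k ℤ.* (B k j ℤ.* cofactor j)) ⟩
          sumℤ (λ j → sumℤ (λ k → c k ℤ.* (B k j ℤ.* cofactor j)))
            ≡⟨ Σℤ.sum-cong-≗ (λ j → Σℤ.sum-cong-≗ (λ k → ℤ.*-assoc (c k) (B k j) (cofactor j))) ⟨
          sumℤ (λ j → sumℤ (λ k → c k ℤ.* B k j ℤ.* cofactor j))
            ≡⟨ Σℤ.sum-cong-≗ (λ j → Σℤ.*-distribʳ-sum (cofactor j) (λ k → c k ℤ.* B k j)) ⟨
          sumℤ (λ j → sumℤ (λ k → c k ℤ.* B k j) ℤ.* cofactor j)
            ≡⟨ Σℤ.sum-cong-≗ (λ j → cong (ℤ._* cofactor j) (rel j)) ⟩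
          sumℤ {suc n} (λ j → 0ℤ)
            ≡⟨ Σℤ.sum-replicate-zero (suc n) ⟩
          0ℤ ∎
        c₀≡0 : c zero ≡ 0ℤ
        c₀≡0 with ℤ.i*j≡0⇒i≡0∨j≡0 (c zero) cΔ≡0
        ... | inj₁ c≡0 = c≡0
        ... | inj₂ Δ≡0 = contradiction Δ≡0 Δ≢0
        rel′ : ∀ j → sumℤ (λ k → c (suc k) ℤ.* A (lookup I k) (suc j)) ≡ 0ℤ
        rel′ j = begin
          sumℤ (λ k → c (suc k) ℤ.* A (lookup I k) (suc j))
            ≡⟨ ℤ.+-identityˡ _ ⟨
          0ℤ ℤ.+ sumℤ (λ k → c (suc k) ℤ.* A (lookup I k) (suc j))
            ≡⟨ cong (λ z → z ℤ.* A i (suc j) ℤ.+ sumℤ (λ k → c (suc k) ℤ.* A (lookup I k) (suc j))) c₀≡0 ⟨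
          sumℤ (λ k → c k ℤ.* B k (suc j))
            ≡⟨ rel (suc j) ⟩
          0ℤ ∎

      separating′ : ∀ (x : Fin (suc n) → ℕ → ℚ) →
        (∀ k → Null (λ s → A (lookup (i ∷ I) k) · (λ j → x j s))) → ∀ j → Null (x j)
      separating′ x null = null-x
        where
        y : Fin (suc n) → ℚ
        y = fromℤ ∘ cofactor
        -- y₀x minus the multiple of y that kills coordinate zero; since the rows
        -- of I are orthogonal to y, its tail falls under the hypothesis on I.
        x̃ : Fin (suc n) → ℕ → ℚ
        x̃ j s = y zero ℚ.* x j s ℚ.- y j ℚ.* x zero s
        x̃₀ : ∀ s → x̃ zero s ≡ 0ℚ
        x̃₀ s = ℚ.+-inverseʳ (y zero ℚ.* x zero s)
        dot-x̃ : ∀ r s → r · (λ j → x̃ j s) ≡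
          y zero ℚ.* r · (λ j → x j s) ℚ.- fromℤ (sumℤ (λ j → r j ℤ.* cofactor j)) ℚ.* x zero s
        dot-x̃ r s = trans (dot-combine r (λ j → x j s) y (y zero) (x zero s))
          (cong (λ q → y zero ℚ.* r · (λ j → x j s) ℚ.- q ℚ.* x zero s) (dot-fromℤ r cofactor))
        null-tail : ∀ k → Null (λ s → (λ j → A (lookup I k) (suc j)) · (λ j → x̃ (suc j) s))
        null-tail k = null-cong
          (λ s → begin
            y zero ℚ.* r · (λ j → x j s)
              ≡⟨ ℚ.+-identityʳ _ ⟨
            y zero ℚ.* r · (λ j → x j s) ℚ.- 0ℚ
              ≡⟨ cong (λ q → y zero ℚ.* r · (λ j → x j s) ℚ.- q)
                   (trans (cong (λ z → fromℤ z ℚ.* x zero s) (orthogonal k)) (ℚ.*-zeroˡ (x zero s))) ⟨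
            y zero ℚ.* r · (λ j → x j s) ℚ.- fromℤ (sumℤ (λ j → r j ℤ.* cofactor j)) ℚ.* x zero s
              ≡⟨ dot-x̃ r s ⟨
            r · (λ j → x̃ j s)
              ≡⟨ cong (ℚ._+ (r ∘ suc) · (λ j → x̃ (suc j) s))
                   (trans (cong (fromℤ (r zero) ℚ.*_) (x̃₀ s)) (ℚ.*-zeroʳ (fromℤ (r zero)))) ⟩
            0ℚ ℚ.+ (r ∘ suc) · (λ j → x̃ (suc j) s)
              ≡⟨ ℚ.+-identityˡ _ ⟩
            (r ∘ suc) · (λ j → x̃ (suc j) s) ∎)
          (null-* (cofactor zero) (null (suc k)))
          where
          open ≡-Reasoning
          r = A (lookup I k)
        null-x̃ : ∀ j → Null (x̃ j)
        null-x̃ zero    = null-cong (λ s → sym (x̃₀ s)) null-0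
        null-x̃ (suc j) = separating (x̃ ∘ suc) null-tail j
        cancel : ∀ p q → p ℚ.- (p ℚ.- q) ≡ q
        cancel = solve 2 (λ p q → p :- (p :- q) := q) refl
          where open +-*-Solver
        cancel′ : ∀ p q → (p ℚ.- q) ℚ.+ q ≡ p
        cancel′ = solve 2 (λ p q → (p :- q) :+ q := p) refl
          where open +-*-Solver
        -- Row `i` applied to `x̃` is `y zero` times row `i` applied to `x`, minus `Δ` times
        -- `x zero`. The first two are null, hence so is the last.
        null-x₀ : Null (x zero)
        null-x₀ = null-cancel Δ Δ≢0 (null-cong
          (λ s → trans (cong (λ q → y zero ℚ.* A i · (λ j → x j s) ℚ.- q) (dot-x̃ (A i) s))
                       (cancel (y zero ℚ.* A i · (λ j → x j s)) (fromℤ Δ ℚ.* x zero s)))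
          (null-+ (null-* (cofactor zero) (null zero))
            (null-neg (null-sum (λ j s → fromℤ (A i j) ℚ.* x̃ j s) (λ j → null-* (A i j) (null-x̃ j))))))
        null-x : ∀ j → Null (x j)
        null-x j = null-cancel (cofactor zero) cofactor₀≢0 (null-cong
          (λ s → cancel′ (y zero ℚ.* x j s) (y j ℚ.* x zero s))
          (null-+ (null-x̃ j) (null-* (cofactor j) null-x₀)))

-- Induction on the columns. A kernel vector for the matrix without column zero is padded by 0. A
-- basis there determines `cofactor`: a row in `P` not orthogonal to it extends the basis, and if
-- there is none, `cofactor` itself is the kernel vector, non-zero in coordinate zero.
basis-or-kernel : ∀ {m n} (A : Matrix ℤ m n) (P : Pred (Fin m) 0ℓ) → Decidable P →
  (∃[ I ] (∀ k → P (lookup I k)) × Basis A I) ⊎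
  (∃ λ (y : Vector ℤ n) → (∃[ j ] y j ≢ 0ℤ) × ∀ i → P i → sumℤ (λ j → A i j ℤ.* y j) ≡ 0ℤ)
basis-or-kernel {n = zero}  A P P? = inj₁ ([] , (λ ()) , record
  { det≢0 = λ () ; independent = λ _ _ () ; separating = λ _ _ () })
basis-or-kernel {m} {suc n} A P P? with basis-or-kernel (λ i j → A i (suc j)) P P?
... | inj₂ (y , (j , y≢0) , ker) = inj₂ (0ℤ Vector.∷ y , (suc j , y≢0) , λ i Pi →
  trans (cong₂ ℤ._+_ (ℤ.*-zeroʳ (A i zero)) (ker i Pi)) refl)
... | inj₁ (I , PI , basis) = by-cases (Fin.any? λ i → P? i ×-dec ¬? (Δ i ℤ.≟ 0ℤ))
  where
  open Extend A I basis
  Δ : Fin m → ℤ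
  Δ i = sumℤ (λ j → A i j ℤ.* cofactor j)
  by-cases : Dec (∃[ i ] P i × Δ i ≢ 0ℤ) → _
  by-cases (yes (i , Pi , Δ≢0)) =
    inj₁ (i ∷ I , (λ { zero → Pi ; (suc k) → PI k }) , extended i Δ≢0)
  by-cases (no none) = inj₂ (cofactor , (zero , cofactor₀≢0) , λ i Pi →
    decidable-stable (Δ i ℤ.≟ 0ℤ) (λ ≢0 → none (i , Pi , ≢0)))

-- Sub-matrices, γ₁ and γ∞

map-∼ : ∀ {X Y : Set} {I J : Vec X k} (f : X → Y) → I ∼ J → Vec.map f I ∼ Vec.map f J
map-∼ f refl∼        = refl∼
map-∼ f (prep∼ p)    = prep∼ (map-∼ f p)
map-∼ f swap∼        = swap∼
map-∼ f (trans∼ p q) = trans∼ (map-∼ f p) (map-∼ f q)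

cons-∈-subsets : ∀ {I : Vec (Fin n) k} → I ∈ subsets k n →
  zero ∷ Vec.map suc I ∈ subsets (suc k) (suc n)
cons-∈-subsets I∈ = ∈-++⁺ˡ (∈-map⁺ (λ I → zero ∷ Vec.map suc I) I∈)

shift-∈-subsets : ∀ {I : Vec (Fin n) k} → I ∈ subsets k n → Vec.map suc I ∈ subsets k (suc n)
shift-∈-subsets {k = zero}  {[]} _  = here refl
shift-∈-subsets {n} {suc k} I∈ =
  ∈-++⁺ʳ (List.map (λ I → zero ∷ Vec.map suc I) (subsets k n)) (∈-map⁺ (Vec.map suc) I∈)

-- A view of membership that is uniform in `k`: `shift` also covers the empty selection, which the
-- recursion of `subsets` treats separately.
data Subset∈ {n} : ∀ {k} → Vec (Fin (suc n)) k → Set where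
  cons  : ∀ {k} {I : Vec (Fin n) k} → I ∈ subsets k n → Subset∈ (zero ∷ Vec.map suc I)
  shift : ∀ {k} {I : Vec (Fin n) k} → I ∈ subsets k n → Subset∈ (Vec.map suc I)

subset∈ : ∀ {I : Vec (Fin (suc n)) k} → I ∈ subsets k (suc n) → Subset∈ I
subset∈ {n} {zero} {[]} _ = shift {I = []} (∈-subsets-zero n)
  where
  ∈-subsets-zero : ∀ n → [] ∈ subsets 0 n
  ∈-subsets-zero zero    = here refl
  ∈-subsets-zero (suc n) = here refl
subset∈ {n} {suc k} I∈ with ∈-++⁻ (List.map (λ I → zero ∷ Vec.map suc I) (subsets k n)) I∈
... | inj₁ p with I , I∈ , refl ← ∈-map⁻ (λ I → zero ∷ Vec.map suc I) p = cons I∈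
... | inj₂ p with I , I∈ , refl ← ∈-map⁻ (Vec.map suc) p = shift I∈

subsets-≤ : ∀ {I : Vec (Fin n) k} → I ∈ subsets k n → k ℕ.≤ n
subsets-≤ {zero}  {zero} I∈ = z≤n
subsets-≤ {suc n} {k} I∈ with subset∈ I∈
... | cons I∈  = s≤s (subsets-≤ I∈)
... | shift I∈ = ℕ.m≤n⇒m≤1+n (subsets-≤ I∈)

-- An index `suc i` never precedes a leading `zero`, so it is swapped behind it and inserted into
-- the tail. The first alternative, `i` already present, will make a determinant vanish.
insert : ∀ (i : Fin n) {I : Vec (Fin n) k} → I ∈ subsets k n →
  (∃[ j ] i ≡ lookup I j) ⊎ (∃[ J ] J ∈ subsets (suc k) n × (i ∷ I) ∼ J)
insert {suc n} zero I∈ with subset∈ I∈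
... | cons  _      = inj₁ (zero , refl)
... | shift {I = I} I∈ = inj₂ (zero ∷ Vec.map suc I , cons-∈-subsets I∈ , refl∼)
insert {suc n} (suc i) I∈ with subset∈ I∈
... | cons {I = I} I∈ with insert i I∈
...   | inj₁ (j , eq)      = inj₁ (suc j , trans (cong suc eq) (sym (Vec.lookup-map j suc I)))
...   | inj₂ (J , J∈ , i∼) = inj₂ (zero ∷ Vec.map suc J , cons-∈-subsets J∈ ,
          trans∼ swap∼ (prep∼ (map-∼ suc i∼)))
insert {suc n} (suc i) I∈ | shift {I = I} I∈′ with insert i I∈′
...   | inj₁ (j , eq)      = inj₁ (j , trans (cong suc eq) (sym (Vec.lookup-map j suc I)))
...   | inj₂ (J , J∈ , i∼) = inj₂ (Vec.map suc J , shift-∈-subsets J∈ , map-∼ suc i∼)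

-- The maximum γ ranges over increasing row selections only, whereas the rows
-- of a basis are found in no particular order.
sort : ∀ (I : Vec (Fin m) k) →
  (∃[ J ] J ∈ subsets k m × I ∼ J) ⊎ (∀ (A : Matrix ℤ m k) → det-rows A I ≡ 0ℤ)
sort {zero}  []      = inj₁ ([] , here refl , refl∼)
sort {suc m} []      = inj₁ ([] , here refl , refl∼)
sort {m} {suc k} (i ∷ I) with sort I
-- Singularity is known for every matrix, in particular for each minor of the expansion along the
-- new row.
... | inj₂ singular = inj₂ λ A → trans
  (Σℤ.sum-cong-≗ {suc k} (λ j → trans
    (cong (sign j ℤ.* A i j ℤ.*_) (singular (λ i l → A i (punchIn j l))))
    (ℤ.*-zeroʳ (sign j ℤ.* A i j))))
  (Σℤ.sum-replicate-zero (suc k))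
... | inj₁ (J , J∈ , I∼J) with insert i J∈
...   | inj₂ (K , K∈ , iJ∼K) = inj₁ (K , K∈ , trans∼ (prep∼ I∼J) iJ∼K)
-- The index `i` occurs twice, so the top row is a copy of a lower one.
...   | inj₁ (j , refl) with e , eq ← det-∼ (prep∼ {x = lookup J j} I∼J) = inj₂ λ A →
        trans (eq A) (trans (cong (e ℤ.*_) (det-repeat (λ i → A (lookup J i)) j)) (ℤ.*-zeroʳ e))

sum-∼ : ∀ {I J : Vec (Fin m) k} (f : Fin m → ℕ) → I ∼ J →
  sumℕ (λ i → f (lookup I i)) ≡ sumℕ (λ i → f (lookup J i))
sum-∼ f refl∼                   = refl
sum-∼ f (prep∼ {x = x} p)         = cong (λ t → f x ℕ.+ t) (sum-∼ f p)
sum-∼ f (swap∼ {x = x} {y} {I}) = ℕ-swap (f x) (f y) (sumℕ (λ i → f (lookup I i)))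
  where
  ℕ-swap : ∀ a b c → a ℕ.+ (b ℕ.+ c) ≡ b ℕ.+ (a ℕ.+ c)
  ℕ-swap a b c = trans (sym (ℕ.+-assoc a b c)) (trans (cong (ℕ._+ c) (ℕ.+-comm a b)) (ℕ.+-assoc b a c))
sum-∼ f (trans∼ p q)            = trans (sum-∼ f p) (sum-∼ f q)

lookup-∼ : ∀ {I J : Vec (Fin m) k} → I ∼ J → ∀ i → ∃[ j ] lookup I i ≡ lookup J j
lookup-∼ refl∼ i = i , refl
lookup-∼ (prep∼ p) zero = zero , refl
lookup-∼ (prep∼ p) (suc i) with j , eq ← lookup-∼ p i = suc j , eq
lookup-∼ swap∼ zero = suc zero , refl
lookup-∼ swap∼ (suc zero) = zero , refl
lookup-∼ swap∼ (suc (suc i)) = suc (suc i) , refl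
lookup-∼ (trans∼ p q) i with j , eq ← lookup-∼ p i with l , eq′ ← lookup-∼ q j = l , trans eq eq′

≤maximum : ∀ (f : Vector ℕ n) i → f i ℕ.≤ maximum f
≤maximum f zero    = ℕ.m≤m⊔n (f zero) _
≤maximum f (suc i) = ℕ.≤-trans (≤maximum (f ∘ suc) i) (ℕ.m≤n⊔m (f zero) _)

maximum≤ : ∀ (f : Vector ℕ n) {c} → (∀ i → f i ℕ.≤ c) → maximum f ℕ.≤ c
maximum≤ {zero}  f f≤c = z≤n
maximum≤ {suc n} f f≤c = ℕ.⊔-lub (f≤c zero) (maximum≤ (f ∘ suc) (f≤c ∘ suc))

allFin∈subsets : ∀ n → Vec.allFin n ∈ subsets n n
allFin∈subsets zero    = here refl
allFin∈subsets (suc n) = subst (λ I → zero ∷ I ∈ subsets (suc n) (suc n))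
  (sym (Vec.tabulate-allFin suc)) (cons-∈-subsets (allFin∈subsets n))

∈⇒≤max : ∀ {xs : List ℕ} {x} → x ∈ xs → x ℕ.≤ List.foldr ℕ._⊔_ 0 xs
∈⇒≤max (here refl) = ℕ.m≤m⊔n _ _
∈⇒≤max {y List.∷ _} (there x∈) = ℕ.≤-trans (∈⇒≤max x∈) (ℕ.m≤n⊔m y _)

max≤ : ∀ (xs : List ℕ) {c} → (∀ {x} → x ∈ xs → x ℕ.≤ c) → List.foldr ℕ._⊔_ 0 xs ℕ.≤ c
max≤ List.[]       ≤c = z≤n
max≤ (x List.∷ xs) ≤c = ℕ.⊔-lub (≤c (here refl)) (max≤ xs (≤c ∘ there))

basisMatrix∈ : ∀ (A : Matrix ℤ m n) {I} → I ∈ subsets n m → det-rows A I ≢ 0ℤ →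
  (n , submatrix A I (Vec.allFin n)) ∈ nonDegenerate A
basisMatrix∈ {m} {n} A {I} I∈ det≢0 = ∈-filter⁺ (λ (_ , B) → ¬? (det B ℤ.≟ 0ℤ))
  (∈-concatMap⁺ sub {xs = List.upTo (suc m)} (Any.map
    (λ { refl → ∈-cartesianProductWith⁺ (λ I J → n , submatrix A I J) I∈ (allFin∈subsets n) })
    (∈-upTo⁺ (s≤s (subsets-≤ I∈)))))
  (λ eq → det≢0 (trans (det-cong _ _ λ i j → cong (A (lookup I i)) (sym (Vec.lookup-allFin j))) eq))
  where
  sub : ℕ → List SquareMatrix
  sub k = List.cartesianProductWith (λ I J → k , submatrix A I J) (subsets k m) (subsets k n)

nonDegenerate-entry : ∀ (A : Matrix ℤ m n) {B : SquareMatrix} → B ∈ nonDegenerate A →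
  ∀ i j → ℤ.∣ proj₂ B i j ∣ ℕ.≤ ∥ A ∥max
nonDegenerate-entry {m} {n} A B∈ =
  let k , B∈k = Any.satisfied (∈-concatMap⁻ sub {xs = List.upTo (suc m)}
                  (proj₁ (∈-filter⁻ (λ (_ , B) → ¬? (det B ℤ.≟ 0ℤ)) {xs = squareSubmatrices A} B∈)))
  in entry (∈-cartesianProductWith⁻ (λ I J → k , submatrix A I J) (subsets k m) (subsets k n) B∈k)
  where
  sub : ℕ → List SquareMatrix
  sub k = List.cartesianProductWith (λ I J → k , submatrix A I J) (subsets k m) (subsets k n)
  entry : ∀ {k} {B : SquareMatrix} →
    (∃[ I ] ∃[ J ] I ∈ subsets k m × J ∈ subsets k n × B ≡ (k , submatrix A I J)) →
    ∀ i j → ℤ.∣ proj₂ B i j ∣ ℕ.≤ ∥ A ∥max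
  entry (I , J , _ , _ , refl) i j = ℕ.≤-trans
    (≤maximum (λ j → ℤ.∣ A (lookup I i) j ∣) (lookup J j))
    (≤maximum (λ i → maximum λ j → ℤ.∣ A i j ∣) (lookup I i))

maxNonDegenerate-∈ : ∀ (f : ∀ {k} → Matrix ℤ k k → ℕ) (A : Matrix ℤ m n) {B} →
  B ∈ nonDegenerate A → f (proj₂ B) ℕ.≤ maxNonDegenerate f A
maxNonDegenerate-∈ f A B∈ = ∈⇒≤max (∈-map⁺ (λ (_ , B) → f B) B∈)

maxNonDegenerate-≤ : ∀ (f : ∀ {k} → Matrix ℤ k k → ℕ) (A : Matrix ℤ m n) {c} →
  (∀ {B} → B ∈ nonDegenerate A → f (proj₂ B) ℕ.≤ c) → maxNonDegenerate f A ℕ.≤ c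
maxNonDegenerate-≤ f A f≤c = max≤ (List.map (λ (_ , B) → f B) (nonDegenerate A)) λ x∈ →
  bound (∈-map⁻ (λ (_ , B) → f B) x∈)
  where
  bound : ∀ {x} → (∃[ B ] B ∈ nonDegenerate A × x ≡ f (proj₂ B)) → x ℕ.≤ _
  bound (B , B∈ , refl) = f≤c B∈

module _ (A : Matrix ℤ m n) (I : Vec (Fin m) n) (det≢0 : det-rows A I ≢ 0ℤ) where

  private
    -- A non-zero determinant rules out a repeated index. It survives sorting, since the factor from
    -- `det-∼` cannot turn 0 into something non-zero.
    sorted : ∃[ J ] I ∼ J × (n , submatrix A J (Vec.allFin n)) ∈ nonDegenerate A
    sorted with sort I
    ... | inj₂ singular = contradiction (singular A) det≢0
    ... | inj₁ (J , J∈ , I∼J) with e , eq ← det-∼ I∼J = J , I∼J , basisMatrix∈ A J∈ λ detJ≡0 →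
          det≢0 (trans (eq A) (trans (cong (e ℤ.*_) detJ≡0) (ℤ.*-zeroʳ e)))

  row-sum≤γ₁ : ∀ i → sumℕ (λ j → ℤ.∣ A (lookup I i) j ∣) ℕ.≤ γ₁ A
  row-sum≤γ₁ i with J , I∼J , J∈ ← sorted with l , eq ← lookup-∼ I∼J i = begin
    sumℕ (λ j → ℤ.∣ A (lookup I i) j ∣)
      ≡⟨ Σℕ.sum-cong-≗ (λ j → cong₂ (λ i j → ℤ.∣ A i j ∣) eq (sym (Vec.lookup-allFin j))) ⟩
    sumℕ (λ j → ℤ.∣ submatrix A J (Vec.allFin n) l j ∣)
      ≤⟨ ≤maximum (λ l → sumℕ λ j → ℤ.∣ submatrix A J (Vec.allFin n) l j ∣) l ⟩
    ∥ submatrix A J (Vec.allFin n) ∥₁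
      ≤⟨ maxNonDegenerate-∈ ∥_∥₁ A J∈ ⟩
    γ₁ A ∎
    where open ℕ.≤-Reasoning

  column-sum≤γ∞ : ∀ j → sumℕ (λ i → ℤ.∣ A (lookup I i) j ∣) ℕ.≤ γ∞ A
  column-sum≤γ∞ j with J , I∼J , J∈ ← sorted = begin
    sumℕ (λ i → ℤ.∣ A (lookup I i) j ∣)
      ≡⟨ sum-∼ (λ i → ℤ.∣ A i j ∣) I∼J ⟩
    sumℕ (λ i → ℤ.∣ A (lookup J i) j ∣)
      ≡⟨ Σℕ.sum-cong-≗ (λ i → cong (λ j → ℤ.∣ A (lookup J i) j ∣) (sym (Vec.lookup-allFin j))) ⟩
    sumℕ (λ i → ℤ.∣ submatrix A J (Vec.allFin n) i j ∣)
      ≤⟨ ≤maximum (λ j → sumℕ λ i → ℤ.∣ submatrix A J (Vec.allFin n) i j ∣) j ⟩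
    ∥ submatrix A J (Vec.allFin n) ∥∞
      ≤⟨ maxNonDegenerate-∈ ∥_∥∞ A J∈ ⟩
    γ∞ A ∎
    where open ℕ.≤-Reasoning

sum-∣∣≤nonZeros : ∀ (v : Vector ℤ n) {c} → (∀ i → ℤ.∣ v i ∣ ℕ.≤ c) →
  sumℕ (λ i → ℤ.∣ v i ∣) ℕ.≤ c ℕ.* nonZeros v
sum-∣∣≤nonZeros {zero}  v {c} v≤c = z≤n
sum-∣∣≤nonZeros {suc n} v {c} v≤c with v zero ℤ.≟ 0ℤ
... | yes v₀≡0 = subst (λ z → ℤ.∣ z ∣ ℕ.+ sumℕ (λ i → ℤ.∣ v (suc i) ∣) ℕ.≤ c ℕ.* nonZeros (v ∘ suc))
                   (sym v₀≡0) (sum-∣∣≤nonZeros (v ∘ suc) (v≤c ∘ suc))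
... | no  _    = ℕ.≤-trans
  (ℕ.+-mono-≤ (v≤c zero) (sum-∣∣≤nonZeros (v ∘ suc) (v≤c ∘ suc)))
  (ℕ.≤-reflexive (sym (ℕ.*-suc c (nonZeros (v ∘ suc)))))

γ₁≤ : ∀ (A : Matrix ℤ m n) → γ₁ A ℕ.≤ ∥ A ∥max ℕ.* maxrs A
γ₁≤ A = maxNonDegenerate-≤ ∥_∥₁ A λ {B} B∈ → maximum≤ (λ i → sumℕ λ j → ℤ.∣ proj₂ B i j ∣) λ i →
  ℕ.≤-trans (sum-∣∣≤nonZeros (proj₂ B i) (nonDegenerate-entry A B∈ i))
    (ℕ.*-monoʳ-≤ ∥ A ∥max (ℕ.≤-trans (≤maximum (λ i → nonZeros (proj₂ B i)) i)
      (maxNonDegenerate-∈ rs A B∈)))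

γ∞≤ : ∀ (A : Matrix ℤ m n) → γ∞ A ℕ.≤ ∥ A ∥max ℕ.* maxcs A
γ∞≤ A = maxNonDegenerate-≤ ∥_∥∞ A λ {B} B∈ → maximum≤ (λ j → sumℕ λ i → ℤ.∣ proj₂ B i j ∣) λ j →
  ℕ.≤-trans (sum-∣∣≤nonZeros (transpose (proj₂ B) j) (λ i → nonDegenerate-entry A B∈ i j))
    (ℕ.*-monoʳ-≤ ∥ A ∥max (ℕ.≤-trans (≤maximum (λ j → nonZeros (transpose (proj₂ B) j)) j)
      (maxNonDegenerate-∈ cs A B∈)))

γ₁,∞≤ : ∀ (A : Matrix ℤ m n) → γ₁,∞ A ℕ.≤ ∥ A ∥max ℕ.* maxts A
γ₁,∞≤ A = ℕ.≤-trans (ℕ.⊓-mono-≤ (γ₁≤ A) (γ∞≤ A))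
  (ℕ.≤-reflexive (sym (ℕ.*-distribˡ-⊓ ∥ A ∥max (maxrs A) (maxcs A))))

-- Counting integer points

lookup-injective : ∀ {X : Set} {xs : List X} → Unique xs → ∀ {i j} →
  List.lookup xs i ≡ List.lookup xs j → i ≡ j
lookup-injective (_  ∷ _) {zero}  {zero}  _  = refl
lookup-injective (x∉ ∷ _) {zero}  {suc j} eq = contradiction eq (All.lookup x∉ (∈-lookup j))
lookup-injective (x∉ ∷ _) {suc i} {zero}  eq = contradiction (sym eq) (All.lookup x∉ (∈-lookup i))
lookup-injective (_  ∷ u) {suc i} {suc j} eq = cong suc (lookup-injective u eq)

injection⇒length-≤ : ∀ {X Y : Set} {xs : List X} {ys : List Y} (f : X → Y) → Unique xs →
  (∀ {x y} → f x ≡ f y → x ≡ y) → (∀ {x} → x ∈ xs → f x ∈ ys) → length xs ℕ.≤ length ys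
injection⇒length-≤ {xs = xs} {ys} f unique inj f∈ = Fin.injective⇒≤ {f = position} position-injective
  where
  position : Fin (length xs) → Fin (length ys)
  position i = Any.index (f∈ (∈-lookup i))
  lookup-position : ∀ i → f (List.lookup xs i) ≡ List.lookup ys (position i)
  lookup-position i = Any.lookup-index (f∈ (∈-lookup i))
  position-injective : ∀ {i j} → position i ≡ position j → i ≡ j
  position-injective {i} {j} eq = lookup-injective unique (inj
    (trans (lookup-position i) (trans (cong (List.lookup ys) eq) (sym (lookup-position j)))))

vectors : ∀ n → ℕ → List (Vec ℕ n)
vectors zero    B = [] List.∷ List.[]
vectors (suc n) B = cartesianProductWith _∷_ (upTo B) (vectors n B)

length-product : ∀ {X Y Z : Set} (f : X → Y → Z) xs ys →
  length (cartesianProductWith f xs ys) ≡ length xs ℕ.* length ys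
length-product f List.[]       ys = refl
length-product f (x List.∷ xs) ys = trans (List.length-++ (List.map (f x) ys))
  (cong₂ ℕ._+_ (List.length-map (f x) ys) (length-product f xs ys))

length-vectors : ∀ n B → length (vectors n B) ≡ B ^ n
length-vectors zero    B = refl
length-vectors (suc n) B = trans (length-product _∷_ (upTo B) (vectors n B))
  (cong₂ ℕ._*_ (List.length-upTo B) (length-vectors n B))

vectors-unique : ∀ n B → Unique (vectors n B)
vectors-unique zero    B = All.[] ∷ []
vectors-unique (suc n) B = Unique.cartesianProductWith⁺ _∷_ Vec.∷-injective (Unique.upTo⁺ B) (vectors-unique n B)

∈-vectors : ∀ {B} (v : Vec ℕ n) → (∀ i → lookup v i ℕ.< B) → v ∈ vectors n B
∈-vectors []      _  = here refl
∈-vectors (x ∷ v) v<B = ∈-cartesianProductWith⁺ _∷_ (∈-upTo⁺ (v<B zero)) (∈-vectors v (v<B ∘ suc))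

-- The sign is stored in the digit: negative numbers use the upper half of the 2γ digits, which is
-- where the factor 2 of the bound comes from. A negative number -(a + 1) is coded by `a`, so that 0
-- is not counted twice.
module Digits (γ : ℕ) .{{_ : NonZero γ}} where

  digit quotient : ℤ → ℕ
  digit (ℤ.+ a)    = a % γ
  digit ℤ.-[1+ a ] = γ ℕ.+ a % γ
  quotient (ℤ.+ a)    = a /ℕ γ
  quotient ℤ.-[1+ a ] = a /ℕ γ

  digit<2γ : ∀ z → digit z ℕ.< 2 ℕ.* γ
  digit<2γ (ℤ.+ a)    = ℕ.<-≤-trans (m%n<n a γ) (ℕ.m≤m+n γ _)
  digit<2γ ℤ.-[1+ a ] = ℕ.+-monoʳ-< γ (ℕ.<-≤-trans (m%n<n a γ) (ℕ.m≤m+n γ 0))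

  γ*quotient≤ : ∀ z → γ ℕ.* quotient z ℕ.≤ ℤ.∣ z ∣
  γ*quotient≤ (ℤ.+ a)    = ℕ.≤-trans (ℕ.≤-reflexive (ℕ.*-comm γ _)) (m/n*n≤m a γ)
  γ*quotient≤ ℤ.-[1+ a ] =
    ℕ.m≤n⇒m≤1+n (ℕ.≤-trans (ℕ.≤-reflexive (ℕ.*-comm γ _)) (m/n*n≤m a γ))

  private
    reconstruct : ∀ a b → a % γ ≡ b % γ → a /ℕ γ ≡ b /ℕ γ → a ≡ b
    reconstruct a b eq% eq/ = trans (m≡m%n+[m/n]*n a γ)
      (trans (cong₂ (λ r q → r ℕ.+ q ℕ.* γ) eq% eq/) (sym (m≡m%n+[m/n]*n b γ)))

    separated : ∀ a b → a % γ ≢ γ ℕ.+ b % γ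
    separated a b eq = ℕ.<⇒≱ (m%n<n a γ) (ℕ.≤-trans (ℕ.m≤m+n γ (b % γ)) (ℕ.≤-reflexive (sym eq)))

  digit-quotient-injective : ∀ z w → digit z ≡ digit w → quotient z ≡ quotient w → z ≡ w
  digit-quotient-injective (ℤ.+ a) (ℤ.+ b) eq% eq/ = cong ℤ.+_ (reconstruct a b eq% eq/)
  digit-quotient-injective (ℤ.+ a) ℤ.-[1+ b ] eq% _ = contradiction eq% (separated a b)
  digit-quotient-injective ℤ.-[1+ a ] (ℤ.+ b) eq% _ = contradiction (sym eq%) (separated b a)
  digit-quotient-injective ℤ.-[1+ a ] ℤ.-[1+ b ] eq% eq/ =
    cong ℤ.-[1+_] (reconstruct a b (ℕ.+-cancelˡ-≡ γ _ _ eq%) eq/)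

-- What the count requires of the sum and of the maximum alike. In `suc≤` the increment `n` is exact
-- for the sum and generous for the maximum; it only has to be independent of `f`.
record IsNorm (n : ℕ) (∥_∥ : Vector ℕ n → ℕ) : Set where
  field
    coordinate≤ : ∀ f i → f i ℕ.≤ ∥ f ∥
    null        : ∥ (λ _ → 0) ∥ ≡ 0
    suc≤        : ∀ f → ∥ suc ∘ f ∥ ℕ.≤ ∥ f ∥ ℕ.+ n
    mono        : ∀ f g → (∀ i → f i ℕ.≤ g i) → ∥ f ∥ ℕ.≤ ∥ g ∥
    scale       : ∀ c f → c ℕ.* ∥ f ∥ ℕ.≤ ∥ (λ i → c ℕ.* f i) ∥

sum-coordinate≤ : ∀ (f : Vector ℕ n) i → f i ℕ.≤ sumℕ f
sum-coordinate≤ f zero    = ℕ.m≤m+n (f zero) _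
sum-coordinate≤ f (suc i) = ℕ.≤-trans (sum-coordinate≤ (f ∘ suc) i) (ℕ.m≤n+m _ (f zero))

sum-mono : ∀ (f g : Vector ℕ n) → (∀ i → f i ℕ.≤ g i) → sumℕ f ℕ.≤ sumℕ g
sum-mono {zero}  f g f≤g = z≤n
sum-mono {suc n} f g f≤g = ℕ.+-mono-≤ (f≤g zero) (sum-mono (f ∘ suc) (g ∘ suc) (f≤g ∘ suc))

sum-suc : ∀ (f : Vector ℕ n) → sumℕ (suc ∘ f) ≡ sumℕ f ℕ.+ n
sum-suc {zero}  f = refl
sum-suc {suc n} f = trans (cong (λ t → suc (f zero ℕ.+ t)) (sum-suc (f ∘ suc))) (lemma (f zero) _ n)
  where
  lemma : ∀ a b c → suc (a ℕ.+ (b ℕ.+ c)) ≡ (a ℕ.+ b) ℕ.+ suc c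
  lemma = solveℕ-∀

sum-isNorm : ∀ n → IsNorm n sumℕ
sum-isNorm n = record
  { coordinate≤ = sum-coordinate≤
  ; null        = Σℕ.sum-replicate-zero n
  ; suc≤        = λ f → ℕ.≤-reflexive (sum-suc f)
  ; mono        = sum-mono
  ; scale       = λ c f → ℕ.≤-reflexive (Σℕ.*-distribˡ-sum c f)
  }

maximum-scale : ∀ c (f : Vector ℕ n) → c ℕ.* maximum f ℕ.≤ maximum (λ i → c ℕ.* f i)
maximum-scale {zero}  c f = ℕ.≤-reflexive (ℕ.*-zeroʳ c)
maximum-scale {suc n} c f = ℕ.≤-trans (ℕ.≤-reflexive (ℕ.*-distribˡ-⊔ c (f zero) (maximum (f ∘ suc))))
  (ℕ.⊔-mono-≤ ℕ.≤-refl (maximum-scale c (f ∘ suc)))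

maximum-isNorm : ∀ n → IsNorm n maximum
maximum-isNorm n = record
  { coordinate≤ = ≤maximum
  ; null        = ℕ.n≤0⇒n≡0 (maximum≤ {n} (λ _ → 0) (λ _ → z≤n))
  -- The index `i` witnesses `n` ≥ 1, so an increase by 1 is covered by `n`.
  ; suc≤        = λ f → maximum≤ (suc ∘ f) λ i → ℕ.≤-trans (s≤s (≤maximum f i)) (+Fin i)
  ; mono        = λ f g f≤g → maximum≤ f λ i → ℕ.≤-trans (f≤g i) (≤maximum g i)
  ; scale       = maximum-scale
  }
  where
  +Fin : ∀ {n t} → Fin n → suc t ℕ.≤ t ℕ.+ n
  +Fin {suc n} {t} _ = ℕ.≤-trans (s≤s (ℕ.m≤m+n t n)) (ℕ.≤-reflexive (sym (ℕ.+-suc t n)))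

-- Exponential against polynomial growth

bernoulli : ∀ K j → (K ℕ.+ j) ℕ.* K ^ j ℕ.≤ K ℕ.* suc K ^ j
bernoulli K zero    = ℕ.≤-reflexive (cong (ℕ._* 1) (ℕ.+-identityʳ K))
bernoulli K (suc j) = begin
  -- The inequality is 1 + j/K ≤ (1 + 1/K)^j with denominators cleared. The added term is the
  -- surplus of (1 + j/K)(1 + 1/K) over 1 + (j + 1)/K.
  (K ℕ.+ suc j) ℕ.* (K ℕ.* K ^ j)                     ≤⟨ ℕ.m≤m+n _ (j ℕ.* K ^ j) ⟩
  (K ℕ.+ suc j) ℕ.* (K ℕ.* K ^ j) ℕ.+ j ℕ.* K ^ j     ≡⟨ lemma K j (K ^ j) ⟩
  suc K ℕ.* ((K ℕ.+ j) ℕ.* K ^ j)                     ≤⟨ ℕ.*-monoʳ-≤ (suc K) (bernoulli K j) ⟩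
  suc K ℕ.* (K ℕ.* suc K ^ j)                         ≡⟨ lemma′ K (suc K ^ j) ⟩
  K ℕ.* (suc K ℕ.* suc K ^ j)                         ∎
  where
  open ℕ.≤-Reasoning
  lemma : ∀ K j p → (K ℕ.+ suc j) ℕ.* (K ℕ.* p) ℕ.+ j ℕ.* p ≡ suc K ℕ.* ((K ℕ.+ j) ℕ.* p)
  lemma = solveℕ-∀
  lemma′ : ∀ K p → suc K ℕ.* (K ℕ.* p) ≡ K ℕ.* (suc K ℕ.* p)
  lemma′ = solveℕ-∀

2*K^K≤ : ∀ K .{{_ : NonZero K}} → 2 ℕ.* K ^ K ℕ.≤ suc K ^ K
2*K^K≤ K = ℕ.*-cancelˡ-≤ K (ℕ.≤-trans (ℕ.≤-reflexive (lemma K (K ^ K))) (bernoulli K K))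
  where
  lemma : ∀ K p → K ℕ.* (2 ℕ.* p) ≡ (K ℕ.+ K) ℕ.* p
  lemma = solveℕ-∀

1+n≤2^n : ∀ n → suc n ℕ.≤ 2 ^ n
1+n≤2^n zero    = ℕ.≤-refl
1+n≤2^n (suc n) = ℕ.≤-trans (ℕ.+-mono-≤ (ℕ.m^n>0 2 n) (1+n≤2^n n))
  (ℕ.≤-reflexive (cong (λ t → 2 ^ n ℕ.+ t) (sym (ℕ.+-identityʳ (2 ^ n)))))

^-distribʳ-* : ∀ a b n → (a ℕ.* b) ^ n ≡ a ^ n ℕ.* b ^ n
^-distribʳ-* a b zero    = refl
^-distribʳ-* a b (suc n) = trans (cong (λ t → a ℕ.* b ℕ.* t) (^-distribʳ-* a b n)) (lemma a b (a ^ n) (b ^ n))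
  where
  lemma : ∀ a b c d → a ℕ.* b ℕ.* (c ℕ.* d) ≡ (a ℕ.* c) ℕ.* (b ℕ.* d)
  lemma = solveℕ-∀

-- A step of length `n` multiplies `f` by at least 1 + 1/K, hence `K * s` steps multiply it by at
-- least 2^s, since (1 + 1/K)^K ≥ 2. This outgrows the polynomial bound.
module Growth (f : ℕ → ℕ) (n K : ℕ) .{{_ : NonZero n}}
  (f0>0 : 0 ℕ.< f 0) (polynomial : ∀ N → f N ℕ.≤ suc N ^ n)
  (step : ∀ N → suc K ℕ.* f N ℕ.≤ K ℕ.* f (N ℕ.+ n)) where

  open ℕ.≤-Reasoning

  iterate : ∀ j → suc K ^ j ℕ.≤ K ^ j ℕ.* f (j ℕ.* n)
  iterate zero    = ℕ.≤-trans f0>0 (ℕ.≤-reflexive (sym (ℕ.+-identityʳ (f 0))))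
  iterate (suc j) = begin
    suc K ℕ.* suc K ^ j                   ≤⟨ ℕ.*-monoʳ-≤ (suc K) (iterate j) ⟩
    suc K ℕ.* (K ^ j ℕ.* f (j ℕ.* n))     ≡⟨ lemma (suc K) (K ^ j) (f (j ℕ.* n)) ⟩
    K ^ j ℕ.* (suc K ℕ.* f (j ℕ.* n))     ≤⟨ ℕ.*-monoʳ-≤ (K ^ j) (step (j ℕ.* n)) ⟩
    K ^ j ℕ.* (K ℕ.* f (j ℕ.* n ℕ.+ n))   ≡⟨ lemma (K ^ j) K _ ⟩
    K ℕ.* (K ^ j ℕ.* f (j ℕ.* n ℕ.+ n))   ≡⟨ ℕ.*-assoc K (K ^ j) _ ⟨
    K ^ suc j ℕ.* f (j ℕ.* n ℕ.+ n)       ≡⟨ cong (λ t → K ^ suc j ℕ.* f t) (ℕ.+-comm (j ℕ.* n) n) ⟩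
    K ^ suc j ℕ.* f (suc j ℕ.* n)         ∎
    where
    lemma : ∀ a b c → a ℕ.* (b ℕ.* c) ≡ b ℕ.* (a ℕ.* c)
    lemma = solveℕ-∀

  exponential : .{{_ : NonZero K}} → ∀ s → 2 ^ s ℕ.≤ f (K ℕ.* s ℕ.* n)
  exponential s = ℕ.*-cancelˡ-≤ (K ^ (K ℕ.* s)) {{ℕ.m^n≢0 K (K ℕ.* s)}} (begin
    K ^ (K ℕ.* s) ℕ.* 2 ^ s             ≡⟨ ℕ.*-comm _ (2 ^ s) ⟩
    2 ^ s ℕ.* K ^ (K ℕ.* s)             ≡⟨ cong (λ t → 2 ^ s ℕ.* t) (ℕ.^-*-assoc K K s) ⟨
    2 ^ s ℕ.* (K ^ K) ^ s               ≡⟨ ^-distribʳ-* 2 (K ^ K) s ⟨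
    (2 ℕ.* K ^ K) ^ s                   ≤⟨ ℕ.^-monoˡ-≤ s (2*K^K≤ K) ⟩
    (suc K ^ K) ^ s                     ≡⟨ ℕ.^-*-assoc (suc K) K s ⟩
    suc K ^ (K ℕ.* s)                   ≤⟨ iterate (K ℕ.* s) ⟩
    K ^ (K ℕ.* s) ℕ.* f (K ℕ.* s ℕ.* n) ∎)

  absurd : .{{_ : NonZero K}} → ⊥
  absurd = ℕ.<⇒≱ (ℕ.^-monoˡ-< n too-big) (begin
    (2 ^ (w ℕ.+ w)) ^ n               ≡⟨ ℕ.^-*-assoc 2 (w ℕ.+ w) n ⟩
    2 ^ ((w ℕ.+ w) ℕ.* n)             ≤⟨ exponential ((w ℕ.+ w) ℕ.* n) ⟩
    f (K ℕ.* ((w ℕ.+ w) ℕ.* n) ℕ.* n) ≤⟨ polynomial _ ⟩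
    suc (K ℕ.* ((w ℕ.+ w) ℕ.* n) ℕ.* n) ^ n ∎)
    where
    -- With s = 2wn both outer terms of 2^s ≤ f(Ksn) ≤ (Ksn + 1)^n are `n`-th powers, and it remains
    -- to compare 4^w with 2wC + 1. As w exceeds 2C, 2wC + 1 < w² + 1 ≤ (w + 1)² ≤ 4^w.
    C = K ℕ.* n ℕ.* n
    w = suc (2 ℕ.* C)
    too-big : suc (K ℕ.* ((w ℕ.+ w) ℕ.* n) ℕ.* n) ℕ.< 2 ^ (w ℕ.+ w)
    too-big = begin-strict
      suc (K ℕ.* ((w ℕ.+ w) ℕ.* n) ℕ.* n)  ≡⟨ cong suc (lemma K n w) ⟩
      suc (w ℕ.* (2 ℕ.* C))                <⟨ s≤s (ℕ.*-monoʳ-< w (ℕ.n<1+n (2 ℕ.* C))) ⟩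
      suc (w ℕ.* w)                        ≤⟨ s≤s (ℕ.m≤n+m (w ℕ.* w) (w ℕ.+ w)) ⟩
      suc (w ℕ.+ w ℕ.+ w ℕ.* w)            ≡⟨ lemma′ w ⟩
      suc w ℕ.* suc w                      ≤⟨ ℕ.*-mono-≤ (1+n≤2^n w) (1+n≤2^n w) ⟩
      2 ^ w ℕ.* 2 ^ w                      ≡⟨ ℕ.^-distribˡ-+-* 2 w w ⟨
      2 ^ (w ℕ.+ w)                        ∎
      where
      lemma : ∀ K n w → K ℕ.* ((w ℕ.+ w) ℕ.* n) ℕ.* n ≡ w ℕ.* (2 ℕ.* (K ℕ.* n ℕ.* n))
      lemma = solveℕ-∀
      lemma′ : ∀ w → suc (w ℕ.+ w ℕ.+ w ℕ.* w) ≡ suc w ℕ.* suc w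
      lemma′ = solveℕ-∀

module Packing {n : ℕ} {∥_∥ : Vector ℕ n → ℕ} (isNorm : IsNorm n ∥_∥) .{{_ : NonZero n}}
  (γ : ℕ) .{{_ : NonZero γ}} where

  open IsNorm isNorm
  open Digits γ

  ball : ℕ → List (Vec ℕ n)
  ball N = filter (λ v → ∥ lookup v ∥ ℕ.≤? N) (vectors n (suc N))

  ∈-ball : ∀ {N} v → ∥ lookup v ∥ ℕ.≤ N → v ∈ ball N
  ∈-ball v v≤N = ∈-filter⁺ (λ v → ∥ lookup v ∥ ℕ.≤? _)
    (∈-vectors v (λ i → s≤s (ℕ.≤-trans (coordinate≤ (lookup v) i) v≤N))) v≤N

  ball-norm : ∀ {N v} → v ∈ ball N → ∥ lookup v ∥ ℕ.≤ N
  ball-norm {N} v∈ = proj₂ (∈-filter⁻ (λ v → ∥ lookup v ∥ ℕ.≤? N) {xs = vectors n (suc N)} v∈)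

  length-ball≤ : ∀ N → length (ball N) ℕ.≤ suc N ^ n
  length-ball≤ N = ℕ.≤-trans (List.length-filter (λ v → ∥ lookup v ∥ ℕ.≤? N) (vectors n (suc N)))
    (ℕ.≤-reflexive (length-vectors n (suc N)))

  length-ball>0 : 0 ℕ.< length (ball 0)
  length-ball>0 = nonempty (∈-ball (Vec.replicate n 0)
    (ℕ.≤-trans (mono _ _ (λ i → ℕ.≤-reflexive (Vec.lookup-replicate i 0))) (ℕ.≤-reflexive null)))
    where
    nonempty : ∀ {xs : List (Vec ℕ n)} {x} → x ∈ xs → 0 ℕ.< length xs
    nonempty (here _)  = s≤s z≤n
    nonempty (there _) = s≤s z≤n

  packing : ∀ k (z : Fin k → Vec ℕ n → Vector ℤ n) →
    (∀ {e e′ s s′} → (∀ j → z e s j ≡ z e′ s′ j) → e ≡ e′ × s ≡ s′) →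
    (∀ e s → ∥ (λ j → ℤ.∣ z e s j ∣) ∥ ℕ.≤ γ ℕ.* ∥ (λ i → suc (lookup s i)) ∥) →
    k ℕ.≤ (2 ℕ.* γ) ^ n
  -- `K < k` turns the comparison of `k` small balls with `K` large ones into growth by the ratio (K
  -- + 1)/K.
  packing k z injective bounded = ℕ.≮⇒≥ λ K<k → Growth.absurd
    (λ N → length (ball N)) n K length-ball>0 length-ball≤
    (λ N → ℕ.≤-trans (ℕ.*-monoˡ-≤ (length (ball N)) K<k) (step N)) {{ℕ.m^n≢0 (2 ℕ.* γ) n {{ℕ.m*n≢0 2 γ}}}}
    where
    K = (2 ℕ.* γ) ^ n
    code : Fin k × Vec ℕ n → Vec ℕ n × Vec ℕ n
    code (e , s) = Vec.tabulate (λ j → digit (z e s j)) , Vec.tabulate (λ j → quotient (z e s j))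
    code-injective : ∀ {x y} → code x ≡ code y → x ≡ y
    code-injective {e , s} {e′ , s′} eq = uncurry (cong₂ _,_) (injective λ j →
      digit-quotient-injective (z e s j) (z e′ s′ j)
        (tabulate-≡ (cong proj₁ eq) j) (tabulate-≡ (cong proj₂ eq) j))
      where
      tabulate-≡ : ∀ {f g : Vector ℕ n} → Vec.tabulate f ≡ Vec.tabulate g → ∀ j → f j ≡ g j
      tabulate-≡ {f} {g} eq j = trans (sym (Vec.lookup∘tabulate f j))
        (trans (cong (λ v → lookup v j) eq) (Vec.lookup∘tabulate g j))
    quotient-norm : ∀ {N s} e → ∥ lookup s ∥ ℕ.≤ N → ∥ (λ j → quotient (z e s j)) ∥ ℕ.≤ N ℕ.+ n
    quotient-norm {N} {s} e s≤N = ℕ.*-cancelˡ-≤ γ (begin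
      γ ℕ.* ∥ (λ j → quotient (z e s j)) ∥      ≤⟨ scale γ _ ⟩
      ∥ (λ j → γ ℕ.* quotient (z e s j)) ∥      ≤⟨ mono _ _ (λ j → γ*quotient≤ (z e s j)) ⟩
      ∥ (λ j → ℤ.∣ z e s j ∣) ∥                 ≤⟨ bounded e s ⟩
      γ ℕ.* ∥ suc ∘ lookup s ∥                  ≤⟨ ℕ.*-monoʳ-≤ γ (suc≤ (lookup s)) ⟩
      γ ℕ.* (∥ lookup s ∥ ℕ.+ n)                ≤⟨ ℕ.*-monoʳ-≤ γ (ℕ.+-monoˡ-≤ n s≤N) ⟩
      γ ℕ.* (N ℕ.+ n)                           ∎)
      where open ℕ.≤-Reasoning
    code-∈ : ∀ {N} {x} → x ∈ cartesianProduct (List.allFin k) (ball N) →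
      code x ∈ cartesianProduct (vectors n (2 ℕ.* γ)) (ball (N ℕ.+ n))
    code-∈ {N} {e , s} x∈ = ∈-cartesianProduct⁺
      (∈-vectors _ λ i → subst (ℕ._< 2 ℕ.* γ) (sym (Vec.lookup∘tabulate _ i)) (digit<2γ (z e s i)))
      (∈-ball _ (ℕ.≤-trans
        (mono _ _ (λ i → ℕ.≤-reflexive (Vec.lookup∘tabulate (λ j → quotient (z e s j)) i)))
        (quotient-norm {s = s} e (ball-norm (proj₂ (∈-cartesianProduct⁻ (List.allFin k) (ball N) x∈))))))
    step : ∀ N → k ℕ.* length (ball N) ℕ.≤ K ℕ.* length (ball (N ℕ.+ n))
    step N = begin
      k ℕ.* length (ball N)
        ≡⟨ cong (ℕ._* length (ball N)) (List.length-tabulate {n = k} (λ i → i)) ⟨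
      length (List.allFin k) ℕ.* length (ball N)
        ≡⟨ length-product _,_ (List.allFin k) (ball N) ⟨
      length (cartesianProduct (List.allFin k) (ball N))
        ≤⟨ injection⇒length-≤ code
             (Unique.cartesianProduct⁺ (Unique.allFin⁺ k)
               (Unique.filter⁺ (λ v → ∥ lookup v ∥ ℕ.≤? N) (vectors-unique n (suc N))))
             code-injective code-∈ ⟩
      length (cartesianProduct (vectors n (2 ℕ.* γ)) (ball (N ℕ.+ n)))
        ≡⟨ length-product _,_ (vectors n (2 ℕ.* γ)) (ball (N ℕ.+ n)) ⟩
      length (vectors n (2 ℕ.* γ)) ℕ.* length (ball (N ℕ.+ n))
        ≡⟨ cong (ℕ._* length (ball (N ℕ.+ n))) (length-vectors n (2 ℕ.* γ)) ⟩
      K ℕ.* length (ball (N ℕ.+ n)) ∎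
      where open ℕ.≤-Reasoning

-- Vertices

-- The double negation shift over a finite index set. It allows all constraints, and all members of
-- a family, to be treated as decided simultaneously while a contradiction is sought.
¬¬-∀ : {P : Fin n → Set} → (∀ i → ¬ ¬ P i) → ¬ ¬ (∀ i → P i)
¬¬-∀ {zero}  ¬¬p ¬all = ¬all λ ()
¬¬-∀ {suc n} ¬¬p ¬all = ¬¬p zero λ p₀ → ¬¬-∀ (¬¬p ∘ suc) λ p → ¬all λ { zero → p₀ ; (suc i) → p i }

seq-sum : (f : Vector ℝ n) (s : ℕ) → seq (sumℝ f) s ≡ sumℚ (λ j → seq (f j) s)
seq-sum {zero}  f s = refl
seq-sum {suc n} f s = cong (λ q → seq (f zero) s ℚ.+ q) (seq-sum (f ∘ suc) s)

at : Vector ℝ n → ℕ → Vector ℚ n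
at v s j = seq (v j) s

Pos : (ℕ → ℚ) → Set
Pos x = ∃[ ε ] 0ℚ ℚ.< ε × ∃[ N ] ∀ s → N ℕ.≤ s → ε ℚ.≤ x s

p≤∣p∣ : ∀ p → p ℚ.≤ ℚ.∣ p ∣
p≤∣p∣ p with ℚ.≤-total 0ℚ p
... | inj₁ 0≤p = ℚ.≤-reflexive (sym (ℚ.0≤p⇒∣p∣≡p 0≤p))
... | inj₂ p≤0 = ℚ.≤-trans p≤0 (ℚ.0≤∣p∣ p)

-- Beyond `N` the terms vary by less than ε/4. Were the single rational term at `N` at least ε/2,
-- all later ones would be at least ε/4 and `x` positive. So it is below ε/2, and later terms stay
-- below ε.
¬pos⇒nonneg-neg : ∀ (x : ℝ) → ¬ Pos (seq x) → Nonneg (λ s → ℚ.- seq x s)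
¬pos⇒nonneg-neg x ¬pos .eventually ε 0<ε with cauchy x (½ ℚ.* (½ ℚ.* ε)) (half-pos (half-pos 0<ε))
... | N , close = N , bound
  where
  open ℚ.≤-Reasoning
  h = ½ ℚ.* ε
  q = ½ ℚ.* h
  upper : ∀ i j → N ℕ.≤ i → N ℕ.≤ j → seq x i ℚ.≤ seq x j ℚ.+ q
  upper i j N≤i N≤j = begin
    seq x i                             ≡⟨ lemma (seq x i) (seq x j) ⟩
    seq x j ℚ.+ (seq x i ℚ.- seq x j)   ≤⟨ ℚ.+-monoʳ-≤ (seq x j) (ℚ.≤-trans (p≤∣p∣ _) (ℚ.<⇒≤ (close i j N≤i N≤j))) ⟩
    seq x j ℚ.+ q                       ∎
    where
    open +-*-Solver
    lemma : ∀ a b → a ≡ b ℚ.+ (a ℚ.- b)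
    lemma = solve 2 (λ a b → a := b :+ (a :- b)) refl
  small : ¬ (h ℚ.≤ seq x N)
  small h≤x = ¬pos (q , half-pos (half-pos 0<ε) , N , λ s N≤s →
    subst₂ ℚ._≤_ (trans (cong (ℚ._- q) (sym (½+½ h))) (lemma q)) (lemma′ (seq x s) q)
      (ℚ.+-monoˡ-≤ (ℚ.- q) (ℚ.≤-trans h≤x (upper N s ℕ.≤-refl N≤s))))
    where
    open +-*-Solver
    lemma : ∀ q → q ℚ.+ q ℚ.- q ≡ q
    lemma = solve 1 (λ q → q :+ q :- q := q) refl
    lemma′ : ∀ a q → a ℚ.+ q ℚ.- q ≡ a
    lemma′ = solve 2 (λ a q → a :+ q :- q := a) refl
  bound : ∀ s → N ℕ.≤ s → 0ℚ ℚ.≤ ℚ.- seq x s ℚ.+ ε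
  bound s N≤s = subst (ℚ._≤ ℚ.- seq x s ℚ.+ ε) (ℚ.+-inverseˡ (seq x s)) (ℚ.+-monoʳ-≤ (ℚ.- seq x s) (begin
    seq x s         ≤⟨ upper s N N≤s ℕ.≤-refl ⟩
    seq x N ℚ.+ q   ≤⟨ ℚ.+-monoˡ-≤ q (ℚ.<⇒≤ (ℚ.≰⇒> small)) ⟩
    h ℚ.+ q         ≤⟨ ℚ.+-monoʳ-≤ h q≤h ⟩
    h ℚ.+ h         ≡⟨ ½+½ ε ⟩
    ε               ∎))
    where
    q≤h : q ℚ.≤ h
    q≤h = subst₂ ℚ._≤_ (ℚ.+-identityʳ q) (½+½ h) (ℚ.+-monoʳ-≤ q (ℚ.<⇒≤ (half-pos (half-pos 0<ε))))

null⇒≈ : ∀ (x y : ℝ) → Null (λ s → seq x s ℚ.- seq y s) → x ≈ y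
null⇒≈ x y (p , q) ε 0<ε with eventually p (½ ℚ.* ε) (half-pos 0<ε) | eventually q (½ ℚ.* ε) (half-pos 0<ε)
... | N , above | M , below = N ℕ.⊔ M , λ s le →
  ℚ.≤-<-trans (abs≤ (seq x s ℚ.- seq y s) (above s (ℕ.m⊔n≤o⇒m≤o N M le)) (below s (ℕ.m⊔n≤o⇒n≤o N M le)))
    (subst₂ ℚ._<_ (ℚ.+-identityʳ h) (½+½ ε) (ℚ.+-monoʳ-< h (half-pos 0<ε)))
  where
  h = ½ ℚ.* ε
  open +-*-Solver
  abs≤ : ∀ d → 0ℚ ℚ.≤ d ℚ.+ h → 0ℚ ℚ.≤ ℚ.- d ℚ.+ h → ℚ.∣ d ∣ ℚ.≤ h
  abs≤ d 0≤d+h 0≤-d+h with ℚ.∣p∣≡p∨∣p∣≡-p d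
  ... | inj₁ eq = subst₂ ℚ._≤_ (trans (ℚ.+-identityʳ d) (sym eq)) (lemma d h) (ℚ.+-monoʳ-≤ d 0≤-d+h)
    where
    lemma : ∀ d h → d ℚ.+ (ℚ.- d ℚ.+ h) ≡ h
    lemma = solve 2 (λ d h → d :+ (:- d :+ h) := h) refl
  ... | inj₂ eq = subst₂ ℚ._≤_ (trans (ℚ.+-identityʳ (ℚ.- d)) (sym eq)) (lemma d h) (ℚ.+-monoʳ-≤ (ℚ.- d) 0≤d+h)
    where
    lemma : ∀ d h → ℚ.- d ℚ.+ (d ℚ.+ h) ≡ h
    lemma = solve 2 (λ d h → :- d :+ (d :+ h) := h) refl

nonneg-sum : ∀ (f : Fin n → ℕ → ℚ) → (∀ k → Nonneg (f k)) → Nonneg (λ s → sumℚ (λ k → f k s))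
nonneg-sum {zero}  f x≥0 = nonneg-0
nonneg-sum {suc n} f x≥0 = nonneg-+ (x≥0 zero) (nonneg-sum (f ∘ suc) (x≥0 ∘ suc))

-- The negative of one summand is the negative of the total plus the remaining summands.
nonneg-summands : ∀ (f : Fin n → ℕ → ℚ) → (∀ k → Nonneg (f k)) →
  Nonneg (λ s → ℚ.- sumℚ (λ k → f k s)) → ∀ k → Nonneg (λ s → ℚ.- f k s)
nonneg-summands f x≥0 nonneg-total zero = nonneg-cong (λ s → lemma (f zero s) (sumℚ (λ k → f (suc k) s)))
  (nonneg-+ nonneg-total (nonneg-sum (f ∘ suc) (x≥0 ∘ suc)))
  where
  open +-*-Solver
  lemma : ∀ a b → ℚ.- (a ℚ.+ b) ℚ.+ b ≡ ℚ.- a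
  lemma = solve 2 (λ a b → :- (a :+ b) :+ b := :- a) refl
nonneg-summands f x≥0 nonneg-total (suc k) = nonneg-summands (f ∘ suc) (x≥0 ∘ suc)
  (nonneg-cong (λ s → lemma (f zero s) (sumℚ (λ k → f (suc k) s))) (nonneg-+ nonneg-total (x≥0 zero))) k
  where
  open +-*-Solver
  lemma : ∀ a b → ℚ.- (a ℚ.+ b) ℚ.+ a ≡ ℚ.- b
  lemma = solve 2 (λ a b → :- (a :+ b) :+ a := :- b) refl

dot-moved : ∀ (r y : Vector ℤ n) (x : Vector ℚ n) c →
  r · (λ j → x j ℚ.+ fromℤ (y j) ℚ.* c) ≡ r · x ℚ.+ fromℤ (sumℤ (λ j → r j ℤ.* y j)) ℚ.* c
dot-moved {zero}  r y x c = sym (trans (ℚ.+-identityˡ (0ℚ ℚ.* c)) (ℚ.*-zeroˡ c))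
dot-moved {suc n} r y x c = begin
  R ℚ.* (x zero ℚ.+ Y ℚ.* c) ℚ.+ (r ∘ suc) · (λ j → x (suc j) ℚ.+ fromℤ (y (suc j)) ℚ.* c)
    ≡⟨ cong (λ q → R ℚ.* (x zero ℚ.+ Y ℚ.* c) ℚ.+ q) (dot-moved (r ∘ suc) (y ∘ suc) (x ∘ suc) c) ⟩
  R ℚ.* (x zero ℚ.+ Y ℚ.* c) ℚ.+ (P ℚ.+ Q ℚ.* c)
    ≡⟨ lemma R (x zero) Y c P Q ⟩
  R ℚ.* x zero ℚ.+ P ℚ.+ (R ℚ.* Y ℚ.+ Q) ℚ.* c
    ≡⟨ cong (λ q → R ℚ.* x zero ℚ.+ P ℚ.+ q ℚ.* c)
         (trans (fromℤ-+ (r zero ℤ.* y zero) (sumℤ (λ j → r (suc j) ℤ.* y (suc j))))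
           (cong (ℚ._+ Q) (fromℤ-* (r zero) (y zero)))) ⟨
  R ℚ.* x zero ℚ.+ P ℚ.+ fromℤ (sumℤ (λ j → r j ℤ.* y j)) ℚ.* c ∎
  where
  open ≡-Reasoning
  open +-*-Solver
  R = fromℤ (r zero)
  Y = fromℤ (y zero)
  P = (r ∘ suc) · (x ∘ suc)
  Q = fromℤ (sumℤ (λ j → r (suc j) ℤ.* y (suc j)))
  lemma : ∀ r x y c p q →
    r ℚ.* (x ℚ.+ y ℚ.* c) ℚ.+ (p ℚ.+ q ℚ.* c) ≡ r ℚ.* x ℚ.+ p ℚ.+ (r ℚ.* y ℚ.+ q) ℚ.* c
  lemma = solve 6 (λ r x y c p q →
    r :* (x :+ y :* c) :+ (p :+ q :* c) := r :* x :+ p :+ (r :* y :+ q) :* c) refl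

minus-minus : ∀ b p q → b ℚ.- p ℚ.- q ≡ b ℚ.- (p ℚ.+ q)
minus-minus = solve 3 (λ b p q → b :- p :- q := b :- (p :+ q)) refl
  where open +-*-Solver

spread : ∀ x y d → (x ℚ.+ y ℚ.* d) ℚ.- (x ℚ.+ y ℚ.* (ℚ.- d)) ≡ y ℚ.* (d ℚ.+ d)
spread = solve 3 (λ x y d → (x :+ y :* d) :- (x :+ y :* (:- d)) := y :* (d :+ d)) refl
  where open +-*-Solver

midpoint : ∀ x y d → x ℚ.- (½ ℚ.* (x ℚ.+ y ℚ.* d) ℚ.+ ½ ℚ.* (x ℚ.+ y ℚ.* (ℚ.- d))) ≡ 0ℚ
midpoint x y d = trans (cong (λ p → x ℚ.- p) (begin
  ½ ℚ.* (x ℚ.+ y ℚ.* d) ℚ.+ ½ ℚ.* (x ℚ.+ y ℚ.* (ℚ.- d))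
    ≡⟨ ℚ.*-distribˡ-+ ½ (x ℚ.+ y ℚ.* d) (x ℚ.+ y ℚ.* (ℚ.- d)) ⟨
  ½ ℚ.* ((x ℚ.+ y ℚ.* d) ℚ.+ (x ℚ.+ y ℚ.* (ℚ.- d)))
    ≡⟨ cong (½ ℚ.*_) (lemma x y d) ⟩
  ½ ℚ.* (x ℚ.+ x)
    ≡⟨ ℚ.*-distribˡ-+ ½ x x ⟩
  ½ ℚ.* x ℚ.+ ½ ℚ.* x
    ≡⟨ ½+½ x ⟩
  x ∎)) (ℚ.+-inverseʳ x)
  where
  open ≡-Reasoning
  open +-*-Solver
  lemma : ∀ x y d → (x ℚ.+ y ℚ.* d) ℚ.+ (x ℚ.+ y ℚ.* (ℚ.- d)) ≡ x ℚ.+ x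
  lemma = solve 3 (λ x y d → (x :+ y :* d) :+ (x :+ y :* (:- d)) := x :+ x) refl

0<½ : 0ℚ ℚ.< ½
0<½ = ℚ.positive⁻¹ ½

0<∣p∣ : ∀ {p} → p ≢ 0ℚ → 0ℚ ℚ.< ℚ.∣ p ∣
0<∣p∣ {p} p≢0 = ℚ.≰⇒> λ ∣p∣≤0 → p≢0 (ℚ.∣p∣≡0⇒p≡0 p (ℚ.≤-antisym ∣p∣≤0 (ℚ.0≤∣p∣ p)))

-- A non-zero `q` is refuted by taking its own absolute value as ε.
constant-difference : ∀ (x y : ℝ) {q} → (∀ s → seq x s ℚ.- seq y s ≡ q) → x ≈ y → q ≡ 0ℚ
constant-difference x y {q} eq x≈y = decidable-stable (q ℚ.≟ 0ℚ) λ q≢0 →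
  let N , close = x≈y ℚ.∣ q ∣ (0<∣p∣ q≢0)
  in ℚ.<-irrefl refl (subst (λ p → ℚ.∣ p ∣ ℚ.< ℚ.∣ q ∣) (eq N) (close N ℕ.≤-refl))

*δ-injective : ∀ δ → 0ℚ ℚ.< δ → ∀ z → fromℤ z ℚ.* (δ ℚ.+ δ) ≡ 0ℚ → z ≡ 0ℤ
*δ-injective δ 0<δ z eq = decidable-stable (z ℤ.≟ 0ℤ) λ z≢0 → ℚ.<-irrefl (sym (begin
  ℚ.∣ fromℤ z ∣ ℚ.* ℚ.∣ δ ℚ.+ δ ∣ ≡⟨ ℚ.∣p*q∣≡∣p∣*∣q∣ (fromℤ z) (δ ℚ.+ δ) ⟨
  ℚ.∣ fromℤ z ℚ.* (δ ℚ.+ δ) ∣     ≡⟨ cong ℚ.∣_∣ eq ⟩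
  0ℚ                              ∎))
  (ℚ.positive⁻¹ (ℚ.∣ fromℤ z ∣ ℚ.* ℚ.∣ δ ℚ.+ δ ∣)
    {{ℚ.pos*pos⇒pos ℚ.∣ fromℤ z ∣ {{ℚ.positive (0<∣p∣ (λ z≡0 → z≢0 (fromℤ-injective {z} {0ℤ} z≡0)))}}
      ℚ.∣ δ ℚ.+ δ ∣ {{ℚ.positive (0<∣p∣ (λ 2δ≡0 → ℚ.<-irrefl (sym 2δ≡0) (ℚ.+-mono-< 0<δ 0<δ)))}}}})
  where open ≡-Reasoning

⊓-pos : ∀ p q → 0ℚ ℚ.< p → 0ℚ ℚ.< q → 0ℚ ℚ.< p ℚ.⊓ q
⊓-pos p q 0<p 0<q = [ (λ eq → subst (0ℚ ℚ.<_) (sym eq) 0<p) , (λ eq → subst (0ℚ ℚ.<_) (sym eq) 0<q) ]′ (ℚ.⊓-sel p q)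

common : (R : Fin n → ℚ → Set) → (∀ i {δ δ′} → δ′ ℚ.≤ δ → R i δ → R i δ′) →
  (∀ i → ∃[ δ ] 0ℚ ℚ.< δ × R i δ) → ∃[ δ ] 0ℚ ℚ.< δ × ∀ i → R i δ
common {zero}  R down rs = 1ℚ , ℚ.positive⁻¹ 1ℚ , λ ()
common {suc n} R down rs =
  let δ₀ , 0<δ₀ , r₀ = rs zero
      δ  , 0<δ  , r  = common (R ∘ suc) (down ∘ suc) (rs ∘ suc)
  in δ₀ ℚ.⊓ δ , ⊓-pos δ₀ δ 0<δ₀ 0<δ , λ
     { zero → down zero (ℚ.p⊓q≤p δ₀ δ) r₀ ; (suc i) → down (suc i) (ℚ.p⊓q≤q δ₀ δ) (r i) }

scale-bound : ∀ r ε → 0ℚ ℚ.< ε → ∃[ δ ] 0ℚ ℚ.< δ × ∀ c → ℚ.∣ c ∣ ℚ.≤ δ → r ℚ.* c ℚ.≤ ε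
scale-bound r ε 0<ε = δ , ℚ.positive⁻¹ δ {{ℚ.pos*pos⇒pos ε (ℚ.1/ D)}} , bound
  where
  -- The summand 1 keeps `D` invertible when `r` is 0.
  D = 1ℚ ℚ.+ ℚ.∣ r ∣
  instance
    D-pos : ℚ.Positive D
    D-pos = ℚ.positive (ℚ.+-mono-<-≤ (ℚ.positive⁻¹ 1ℚ) (ℚ.0≤∣p∣ r))
    D-nonZero : ℚ.NonZero D
    D-nonZero = ℚ.pos⇒nonZero D
    ε-pos : ℚ.Positive ε
    ε-pos = ℚ.positive 0<ε
    1/D-pos : ℚ.Positive (ℚ.1/ D)
    1/D-pos = ℚ.1/pos⇒pos D
  δ = ε ℚ.* ℚ.1/ D
  bound : ∀ c → ℚ.∣ c ∣ ℚ.≤ δ → r ℚ.* c ℚ.≤ ε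
  bound c c≤δ = begin
    r ℚ.* c                ≤⟨ p≤∣p∣ (r ℚ.* c) ⟩
    ℚ.∣ r ℚ.* c ∣          ≡⟨ ℚ.∣p*q∣≡∣p∣*∣q∣ r c ⟩
    ℚ.∣ r ∣ ℚ.* ℚ.∣ c ∣    ≤⟨ ℚ.*-monoʳ-≤-nonNeg ℚ.∣ c ∣ {{ℚ.∣-∣-nonNeg c}} ∣r∣≤D ⟩
    D ℚ.* ℚ.∣ c ∣          ≤⟨ ℚ.*-monoˡ-≤-nonNeg D {{ℚ.pos⇒nonNeg D}} c≤δ ⟩
    D ℚ.* (ε ℚ.* ℚ.1/ D)   ≡⟨ lemma D ε (ℚ.1/ D) ⟩
    ε ℚ.* (D ℚ.* ℚ.1/ D)   ≡⟨ cong (ε ℚ.*_) (ℚ.*-inverseʳ D) ⟩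
    ε ℚ.* 1ℚ               ≡⟨ ℚ.*-identityʳ ε ⟩
    ε                      ∎
    where
    open ℚ.≤-Reasoning
    open +-*-Solver
    ∣r∣≤D : ℚ.∣ r ∣ ℚ.≤ D
    ∣r∣≤D = subst (ℚ._≤ D) (ℚ.+-identityˡ ℚ.∣ r ∣) (ℚ.+-monoˡ-≤ ℚ.∣ r ∣ (ℚ.<⇒≤ (ℚ.positive⁻¹ 1ℚ)))
    lemma : ∀ D ε r → D ℚ.* (ε ℚ.* r) ≡ ε ℚ.* (D ℚ.* r)
    lemma = solve 3 (λ D ε r → D :* (ε :* r) := ε :* (D :* r)) refl

pos⇒nonneg-minus : ∀ {x : ℕ → ℚ} {ε r} → (∃[ N ] ∀ s → N ℕ.≤ s → ε ℚ.≤ x s) → r ℚ.≤ ε →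
  Nonneg (λ s → x s ℚ.- r)
pos⇒nonneg-minus {x} {ε} {r} (N , ε≤x) r≤ε .eventually ε′ 0<ε′ = N , λ s N≤s → ℚ.+-mono-≤
  (subst (ℚ._≤ x s ℚ.- r) (ℚ.+-inverseʳ r) (ℚ.+-monoˡ-≤ (ℚ.- r) (ℚ.≤-trans r≤ε (ε≤x s N≤s))))
  (ℚ.<⇒≤ 0<ε′)

≤⇒nonneg : ∀ (x y : ℝ) → x ≤ y → Nonneg (λ s → seq y s ℚ.- seq x s)
≤⇒nonneg x y x≤y .eventually ε 0<ε with N , p ← x≤y ε 0<ε = N , λ s N≤s →
  subst₂ ℚ._≤_ (ℚ.+-inverseʳ (seq x s)) (lemma (seq y s) ε (seq x s)) (ℚ.+-monoˡ-≤ (ℚ.- seq x s) (p s N≤s))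
  where
  open +-*-Solver
  lemma : ∀ b ε x → b ℚ.+ ε ℚ.- x ≡ b ℚ.- x ℚ.+ ε
  lemma = solve 3 (λ b ε x → b :+ ε :- x := b :- x :+ ε) refl

nonneg⇒≤ : ∀ (x y : ℝ) → Nonneg (λ s → seq y s ℚ.- seq x s) → x ≤ y
nonneg⇒≤ x y x≥0 ε 0<ε with N , p ← eventually x≥0 ε 0<ε = N , λ s N≤s →
  subst₂ ℚ._≤_ (ℚ.+-identityʳ (seq x s)) (lemma (seq y s) ε (seq x s)) (ℚ.+-monoʳ-≤ (seq x s) (p s N≤s))
  where
  open +-*-Solver
  lemma : ∀ b ε x → x ℚ.+ (b ℚ.- x ℚ.+ ε) ≡ b ℚ.+ ε
  lemma = solve 3 (λ b ε x → x :+ (b :- x :+ ε) := b :+ ε) refl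

-- Tight bases at vertices and the cones they span

module Polyhedral (A : Matrix ℤ m n) (b : Vector ℚ m) where

  gap : Fin m → Vector ℝ n → ℝ
  gap i v = fromℚ (b i) - sumℝ (λ j → fromℚ (fromℤ (A i j)) * v j)

  gap-dot : ∀ i v s → seq (gap i v) s ≡ b i ℚ.- A i · at v s
  gap-dot i v s = cong (λ q → b i ℚ.- q) (seq-sum (λ j → fromℚ (fromℤ (A i j)) * v j) s)

  gap-nonneg : ∀ v → Polyhedron A b v → ∀ i → Nonneg (seq (gap i v))
  gap-nonneg v Pv i = ≤⇒nonneg (sumℝ (λ j → fromℚ (fromℤ (A i j)) * v j)) (fromℚ (b i)) (Pv i)

  nonneg-gap : ∀ v → (∀ i → Nonneg (λ s → b i ℚ.- A i · at v s)) → Polyhedron A b v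
  nonneg-gap v x≥0 i = nonneg⇒≤ (sumℝ (λ j → fromℚ (fromℤ (A i j)) * v j)) (fromℚ (b i))
    (nonneg-cong (λ s → sym (gap-dot i v s)) (x≥0 i))

  TightBasis : Vector ℝ n → Vec (Fin m) n → Set
  TightBasis v I = (∀ k → Null (seq (gap (lookup I k) v))) × Basis A I

  -- A slack constraint tolerates a short move in any direction, and a constraint orthogonal to `y`
  -- any move along `y`. The disjunction `room` supplies the choice, so nothing about tightness is
  -- decided here.
  module Perturb (v : Vector ℝ n) (Pv : Polyhedron A b v) (y : Vector ℤ n)
    (room : ∀ i → Pos (seq (gap i v)) ⊎ sumℤ (λ j → A i j ℤ.* y j) ≡ 0ℤ) where

    slope : Fin m → ℚ
    slope i = fromℤ (sumℤ (λ j → A i j ℤ.* y j))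

    Room : Fin m → ℚ → Set
    Room i δ = ∀ c → ℚ.∣ c ∣ ℚ.≤ δ → Nonneg (λ s → seq (gap i v) s ℚ.- slope i ℚ.* c)

    single : ∀ i → ∃[ δ ] 0ℚ ℚ.< δ × Room i δ
    single i = [ slack , flat ]′ (room i)
      where
      slack : Pos (seq (gap i v)) → ∃[ δ ] 0ℚ ℚ.< δ × Room i δ
      slack (ε , 0<ε , late) =
        let δ , 0<δ , bound = scale-bound (slope i) ε 0<ε
        in δ , 0<δ , λ c c≤δ → pos⇒nonneg-minus {seq (gap i v)} {ε} late (bound c c≤δ)
      flat : sumℤ (λ j → A i j ℤ.* y j) ≡ 0ℤ → ∃[ δ ] 0ℚ ℚ.< δ × Room i δ
      flat slope≡0 = 1ℚ , ℚ.positive⁻¹ 1ℚ , λ c _ → nonneg-cong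
        (λ s → sym (trans (cong (λ q → seq (gap i v) s ℚ.- q)
          (trans (cong (λ z → fromℤ z ℚ.* c) slope≡0) (ℚ.*-zeroˡ c))) (ℚ.+-identityʳ (seq (gap i v) s))))
        (gap-nonneg v Pv i)

    moved : ℚ → Vector ℝ n
    moved c j = v j + fromℚ (fromℤ (y j) ℚ.* c)

    gap-moved : ∀ i c s → seq (gap i v) s ℚ.- slope i ℚ.* c ≡ b i ℚ.- A i · at (moved c) s
    gap-moved i c s = trans (cong (ℚ._- slope i ℚ.* c) (gap-dot i v s))
      (trans (minus-minus (b i) (A i · at v s) (slope i ℚ.* c))
        (cong (λ q → b i ℚ.- q) (sym (dot-moved (A i) y (at v s) c))))

    polyhedron-moved : ∃[ δ ] 0ℚ ℚ.< δ × ∀ c → ℚ.∣ c ∣ ℚ.≤ δ → Polyhedron A b (moved c)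
    polyhedron-moved =
      let δ , 0<δ , rooms = common Room (λ i δ′≤δ r c c≤δ′ → r c (ℚ.≤-trans c≤δ′ δ′≤δ)) single
      in δ , 0<δ , λ c c≤δ → nonneg-gap (moved c) λ i → nonneg-cong (gap-moved i c) (rooms i c c≤δ)

    -- `v` is the midpoint of the points moved by δ and by -δ. Extremality identifies these, while
    -- their coordinates `j` differ by the constant 2δ times `y j`.
    vertex⇒y≡0 : IsVertex (Polyhedron A b) v → ∀ j → y j ≡ 0ℤ
    vertex⇒y≡0 (_ , extreme) j =
      let δ , 0<δ , inside = polyhedron-moved
          ∣δ∣≤δ = ℚ.≤-reflexive (ℚ.0≤p⇒∣p∣≡p (ℚ.<⇒≤ 0<δ))
          same = extreme (moved δ) (moved (ℚ.- δ)) (fromℚ ½)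
            (inside δ ∣δ∣≤δ) (inside (ℚ.- δ) (ℚ.≤-trans (ℚ.≤-reflexive (ℚ.∣-p∣≡∣p∣ δ)) ∣δ∣≤δ))
            (½ , 0<½ , 0 , λ _ _ → ℚ.≤-refl) (½ , 0<½ , 0 , λ _ _ → ℚ.≤-refl)
            (λ j → null⇒≈ (v j) (fromℚ ½ * moved δ j + (1ℝ - fromℚ ½) * moved (ℚ.- δ) j)
              (null-cong (λ s → sym (midpoint (seq (v j) s) (fromℤ (y j)) δ)) null-0))
      in *δ-injective δ 0<δ (y j) (constant-difference (moved δ j) (moved (ℚ.- δ) j)
           (λ s → spread (seq (v j) s) (fromℤ (y j)) δ) (same j))

  -- `basis-or-kernel` needs a decidable set of rows, and being tight, the negation of `Pos`, is
  -- decidable only under a double negation.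
  vertex⇒tightBasis : ∀ v → IsVertex (Polyhedron A b) v → ¬ ¬ (∃[ I ] TightBasis v I)
  vertex⇒tightBasis v vertex@(Pv , _) ¬basis =
    ¬¬-∀ {P = λ i → Dec (Pos (seq (gap i v)))} (λ i → ¬¬-excluded-middle) λ pos? →
      ¬basis (find pos? (basis-or-kernel A (λ i → ¬ Pos (seq (gap i v))) (λ i → ¬? (pos? i))))
    where
    find : (∀ i → Dec (Pos (seq (gap i v)))) →
      (∃[ I ] (∀ k → ¬ Pos (seq (gap (lookup I k) v))) × Basis A I) ⊎
      (∃ λ (y : Vector ℤ n) → (∃[ j ] y j ≢ 0ℤ) ×
        ∀ i → ¬ Pos (seq (gap i v)) → sumℤ (λ j → A i j ℤ.* y j) ≡ 0ℤ) →
      ∃[ I ] TightBasis v I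
    find pos? (inj₁ (I , tight , basis)) = I , (λ k →
      gap-nonneg v Pv (lookup I k) , ¬pos⇒nonneg-neg (gap (lookup I k) v) (tight k)) , basis
    find pos? (inj₂ (y , (j , y≢0) , kernel)) = contradiction (Perturb.vertex⇒y≡0 v Pv y room vertex j) y≢0
      where
      room : ∀ i → Pos (seq (gap i v)) ⊎ sumℤ (λ j → A i j ℤ.* y j) ≡ 0ℤ
      room i = Sum.map₂ (kernel i) (toSum (pos? i))

  -- Adding 1 keeps every coefficient positive, hence the point inside the open cone. On their
  -- boundaries the cones of two vertices may meet.
  cone : Vec (Fin m) n → Vec ℕ n → Vector ℤ n
  cone I s j = sumℤ (λ k → ℤ.+ suc (lookup s k) ℤ.* A (lookup I k) j)

  cone-dot : ∀ I s x → cone I s · x ≡ sumℚ (λ k → fromℤ (ℤ.+ suc (lookup s k)) ℚ.* A (lookup I k) · x)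
  cone-dot I s x = begin
    sumℚ (λ j → fromℤ (cone I s j) ℚ.* x j)
      ≡⟨ Σℚ.sum-cong-≗ (λ j → trans
           (cong (ℚ._* x j) (fromℤ-sum (λ k → c k ℤ.* A (lookup I k) j)))
           (Σℚ.*-distribʳ-sum (x j) (λ k → fromℤ (c k ℤ.* A (lookup I k) j)))) ⟩
    sumℚ (λ j → sumℚ (λ k → fromℤ (c k ℤ.* A (lookup I k) j) ℚ.* x j))
      ≡⟨ Σℚ.∑-comm (λ j k → fromℤ (c k ℤ.* A (lookup I k) j) ℚ.* x j) ⟩
    sumℚ (λ k → sumℚ (λ j → fromℤ (c k ℤ.* A (lookup I k) j) ℚ.* x j))
      ≡⟨ Σℚ.sum-cong-≗ (λ k → trans
           (Σℚ.sum-cong-≗ (λ j → trans (cong (ℚ._* x j) (fromℤ-* (c k) (A (lookup I k) j)))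
             (ℚ.*-assoc (fromℤ (c k)) (fromℤ (A (lookup I k) j)) (x j))))
           (sym (Σℚ.*-distribˡ-sum (fromℤ (c k)) (λ j → fromℤ (A (lookup I k) j) ℚ.* x j)))) ⟩
    sumℚ (λ k → fromℤ (c k) ℚ.* A (lookup I k) · x) ∎
    where
    open ≡-Reasoning
    c : Vector ℤ n
    c k = ℤ.+ suc (lookup s k)

  -- The row applied to v - w is the gap at `w`, which is at least 0, minus the gap at `v`, which is
  -- null.
  descent : ∀ v w {I} → TightBasis v I → Polyhedron A b w → ∀ k →
    Nonneg (λ s → A (lookup I k) · (λ j → at v s j ℚ.- at w s j))
  descent v w {I} (tight , _) Pw k = nonneg-cong
    (λ s → trans (cong₂ (λ p q → p ℚ.+ ℚ.- q) (gap-dot (lookup I k) w s) (gap-dot (lookup I k) v s))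
      (trans (lemma (b (lookup I k)) (A (lookup I k) · at w s) (A (lookup I k) · at v s))
        (sym (dot-minus (A (lookup I k)) (at v s) (at w s)))))
    (nonneg-+ (gap-nonneg w Pw (lookup I k)) (proj₂ (tight k)))
    where
    open +-*-Solver
    lemma : ∀ b x y → (b ℚ.- x) ℚ.+ ℚ.- (b ℚ.- y) ≡ y ℚ.- x
    lemma = solve 3 (λ b x y → (b :- x) :+ :- (b :- y) := y :- x) refl
    dot-minus : ∀ r x y → r · (λ j → x j ℚ.- y j) ≡ r · x ℚ.- r · y
    dot-minus r x y = trans
      (Σℚ.sum-cong-≗ (λ j → cong (fromℤ (r j) ℚ.*_) (cong₂ ℚ._-_ (sym (ℚ.*-identityˡ (x j))) (sym (ℚ.*-identityʳ (y j))))))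
      (trans (dot-combine r x y 1ℚ 1ℚ) (cong₂ ℚ._-_ (ℚ.*-identityˡ (r · x)) (ℚ.*-identityʳ (r · y))))

  -- By `descent`, a common point of the cones has a product with v - w that is at least 0 and, with
  -- the roles exchanged, at most 0. The product is a sum of positive multiples of nonnegative
  -- terms, so each row of `I` annihilates v - w in the limit, and `separating` applies.
  cones-disjoint : ∀ v w {I J s t} → Polyhedron A b v → Polyhedron A b w →
    TightBasis v I → TightBasis w J → (∀ j → cone I s j ≡ cone J t j) → v ≋ w
  cones-disjoint v w {I} {J} {s} {t} Pv Pw tightI tightJ eq j =
    null⇒≈ (v j) (w j) (Basis.separating (proj₂ tightI) (λ j r → at v r j ℚ.- at w r j) null j)
    where
    q : Fin n → ℕ → ℚ
    q k r = A (lookup I k) · (λ j → at v r j ℚ.- at w r j)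
    q′ : Fin n → ℕ → ℚ
    q′ k r = A (lookup J k) · (λ j → at w r j ℚ.- at v r j)
    nonneg-q : ∀ k → Nonneg (λ r → fromℤ (ℤ.+ suc (lookup s k)) ℚ.* q k r)
    nonneg-q k = nonneg-ℕ* (suc (lookup s k)) (descent v w {I} tightI Pw k)
    flip : ∀ r → sumℚ (λ k → fromℤ (ℤ.+ suc (lookup t k)) ℚ.* q′ k r) ≡
                 ℚ.- sumℚ (λ k → fromℤ (ℤ.+ suc (lookup s k)) ℚ.* q k r)
    flip r = begin
      sumℚ (λ k → fromℤ (ℤ.+ suc (lookup t k)) ℚ.* q′ k r)
        ≡⟨ cone-dot J t (λ j → at w r j ℚ.- at v r j) ⟨
      cone J t · (λ j → at w r j ℚ.- at v r j)
        ≡⟨ Σℚ.sum-cong-≗ (λ j → trans (cong (λ z → fromℤ z ℚ.* (at w r j ℚ.- at v r j)) (sym (eq j)))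
             (lemma (fromℤ (cone I s j)) (at v r j) (at w r j))) ⟩
      sumℚ (λ j → ℚ.- 1ℚ ℚ.* (fromℤ (cone I s j) ℚ.* (at v r j ℚ.- at w r j)))
        ≡⟨ Σℚ.*-distribˡ-sum (ℚ.- 1ℚ) (λ j → fromℤ (cone I s j) ℚ.* (at v r j ℚ.- at w r j)) ⟨
      ℚ.- 1ℚ ℚ.* cone I s · (λ j → at v r j ℚ.- at w r j)
        ≡⟨ ℚ±.-1*x≈-x _ ⟩
      ℚ.- (cone I s · (λ j → at v r j ℚ.- at w r j))
        ≡⟨ cong ℚ.-_ (cone-dot I s (λ j → at v r j ℚ.- at w r j)) ⟩
      ℚ.- sumℚ (λ k → fromℤ (ℤ.+ suc (lookup s k)) ℚ.* q k r) ∎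
      where
      open ≡-Reasoning
      open +-*-Solver
      lemma : ∀ z x y → z ℚ.* (y ℚ.- x) ≡ ℚ.- 1ℚ ℚ.* (z ℚ.* (x ℚ.- y))
      lemma = solve 3 (λ z x y → z :* (y :- x) := con (ℚ.- 1ℚ) :* (z :* (x :- y))) refl
    null : ∀ k → Null (q k)
    null k = null-cancel (ℤ.+ suc (lookup s k)) (λ ()) (nonneg-q k ,
      nonneg-summands (λ k r → fromℤ (ℤ.+ suc (lookup s k)) ℚ.* q k r) nonneg-q
        (nonneg-cong flip (nonneg-sum (λ k r → fromℤ (ℤ.+ suc (lookup t k)) ℚ.* q′ k r)
          (λ k → nonneg-ℕ* (suc (lookup t k)) (descent w v {J} tightJ Pv k)))) k)

  cone-injective : ∀ {I} → Basis A I → ∀ {s t} → (∀ j → cone I s j ≡ cone I t j) → s ≡ t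
  cone-injective {I} basis {s} {t} eq = trans (sym (Vec.tabulate∘lookup s))
    (trans (Vec.tabulate-cong λ k → ℕ.suc-injective (ℤ.+-injective (ℤ.i-j≡0⇒i≡j _ _ (Basis.independent basis c relation k))))
      (Vec.tabulate∘lookup t))
    where
    open ≡-Reasoning
    c : Vector ℤ n
    c k = ℤ.+ suc (lookup s k) ℤ.- ℤ.+ suc (lookup t k)
    relation : ∀ j → sumℤ (λ k → c k ℤ.* A (lookup I k) j) ≡ 0ℤ
    relation j = begin
      sumℤ (λ k → c k ℤ.* A (lookup I k) j)
        ≡⟨ Σℤ.sum-cong-≗ (λ k → lemma (ℤ.+ suc (lookup s k)) (ℤ.+ suc (lookup t k)) (A (lookup I k) j)) ⟩
      sumℤ (λ k → ℤ.+ suc (lookup s k) ℤ.* A (lookup I k) j ℤ.+ -1ℤ ℤ.* (ℤ.+ suc (lookup t k) ℤ.* A (lookup I k) j))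
        ≡⟨ Σℤ.∑-distrib-+ (λ k → ℤ.+ suc (lookup s k) ℤ.* A (lookup I k) j)
             (λ k → -1ℤ ℤ.* (ℤ.+ suc (lookup t k) ℤ.* A (lookup I k) j)) ⟩
      cone I s j ℤ.+ sumℤ (λ k → -1ℤ ℤ.* (ℤ.+ suc (lookup t k) ℤ.* A (lookup I k) j))
        ≡⟨ cong₂ ℤ._+_ (eq j) (sym (Σℤ.*-distribˡ-sum -1ℤ (λ k → ℤ.+ suc (lookup t k) ℤ.* A (lookup I k) j))) ⟩
      cone I t j ℤ.+ -1ℤ ℤ.* cone I t j
        ≡⟨ cancel (cone I t j) ⟩
      0ℤ ∎
      where
      lemma : ∀ a b c → (a ℤ.- b) ℤ.* c ≡ a ℤ.* c ℤ.+ -1ℤ ℤ.* (b ℤ.* c)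
      lemma = solve-∀
      cancel : ∀ a → a ℤ.+ -1ℤ ℤ.* a ≡ 0ℤ
      cancel = solve-∀

  ∣cone∣≤ : ∀ I s j → ℤ.∣ cone I s j ∣ ℕ.≤ sumℕ (λ k → suc (lookup s k) ℕ.* ℤ.∣ A (lookup I k) j ∣)
  ∣cone∣≤ I s j = ℕ.≤-trans (∣sum∣≤ (λ k → ℤ.+ suc (lookup s k) ℤ.* A (lookup I k) j))
    (ℕ.≤-reflexive (Σℕ.sum-cong-≗ (λ k → ℤ.abs-* (ℤ.+ suc (lookup s k)) (A (lookup I k) j))))
    where
    ∣sum∣≤ : ∀ {n} (f : Vector ℤ n) → ℤ.∣ sumℤ f ∣ ℕ.≤ sumℕ (λ i → ℤ.∣ f i ∣)
    ∣sum∣≤ {zero}  f = z≤n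
    ∣sum∣≤ {suc n} f = ℕ.≤-trans (ℤ.∣i+j∣≤∣i∣+∣j∣ (f zero) (sumℤ (f ∘ suc)))
      (ℕ.+-monoʳ-≤ ℤ.∣ f zero ∣ (∣sum∣≤ (f ∘ suc)))

  -- Summing over the coordinates first, each coefficient is multiplied by the absolute sum of its
  -- own row, hence γ₁.
  cone-sum≤ : ∀ {I} → Basis A I → ∀ s →
    sumℕ (λ j → ℤ.∣ cone I s j ∣) ℕ.≤ γ₁ A ℕ.* sumℕ (λ k → suc (lookup s k))
  cone-sum≤ {I} basis s = begin
    sumℕ (λ j → ℤ.∣ cone I s j ∣)
      ≤⟨ sum-mono _ _ (∣cone∣≤ I s) ⟩
    sumℕ (λ j → sumℕ (λ k → suc (lookup s k) ℕ.* ℤ.∣ A (lookup I k) j ∣))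
      ≡⟨ Σℕ.∑-comm (λ j k → suc (lookup s k) ℕ.* ℤ.∣ A (lookup I k) j ∣) ⟩
    sumℕ (λ k → sumℕ (λ j → suc (lookup s k) ℕ.* ℤ.∣ A (lookup I k) j ∣))
      ≡⟨ Σℕ.sum-cong-≗ (λ k → Σℕ.*-distribˡ-sum (suc (lookup s k)) (λ j → ℤ.∣ A (lookup I k) j ∣)) ⟨
    sumℕ (λ k → suc (lookup s k) ℕ.* sumℕ (λ j → ℤ.∣ A (lookup I k) j ∣))
      ≤⟨ sum-mono _ _ (λ k → ℕ.*-monoʳ-≤ (suc (lookup s k)) (row-sum≤γ₁ A I (Basis.det≢0 basis) k)) ⟩
    sumℕ (λ k → suc (lookup s k) ℕ.* γ₁ A)
      ≡⟨ Σℕ.*-distribʳ-sum (γ₁ A) (λ k → suc (lookup s k)) ⟨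
    sumℕ (λ k → suc (lookup s k)) ℕ.* γ₁ A
      ≡⟨ ℕ.*-comm _ (γ₁ A) ⟩
    γ₁ A ℕ.* sumℕ (λ k → suc (lookup s k)) ∎
    where open ℕ.≤-Reasoning

  -- In a fixed coordinate the coefficients meet the entries of one column of the basis, hence γ∞.
  cone-max≤ : ∀ {I} → Basis A I → ∀ s →
    maximum (λ j → ℤ.∣ cone I s j ∣) ℕ.≤ γ∞ A ℕ.* maximum (λ k → suc (lookup s k))
  cone-max≤ {I} basis s = maximum≤ _ λ j → begin
    ℤ.∣ cone I s j ∣
      ≤⟨ ∣cone∣≤ I s j ⟩
    sumℕ (λ k → suc (lookup s k) ℕ.* ℤ.∣ A (lookup I k) j ∣)
      ≤⟨ sum-mono _ _ (λ k → ℕ.*-monoˡ-≤ ℤ.∣ A (lookup I k) j ∣ (≤maximum (λ k → suc (lookup s k)) k)) ⟩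
    sumℕ (λ k → M ℕ.* ℤ.∣ A (lookup I k) j ∣)
      ≡⟨ Σℕ.*-distribˡ-sum M (λ k → ℤ.∣ A (lookup I k) j ∣) ⟨
    M ℕ.* sumℕ (λ k → ℤ.∣ A (lookup I k) j ∣)
      ≤⟨ ℕ.*-monoʳ-≤ M (column-sum≤γ∞ A I (Basis.det≢0 basis) j) ⟩
    M ℕ.* γ∞ A
      ≡⟨ ℕ.*-comm M (γ∞ A) ⟩
    γ∞ A ℕ.* M ∎
    where
    open ℕ.≤-Reasoning
    M = maximum (λ k → suc (lookup s k))

-- If all entries were 0, the coefficients 1 would give a relation; there is at least one row, so
-- this contradicts independence.
basis-entry≢0 : ∀ {m n} (A : Matrix ℤ m (suc n)) {I} → Basis A I →
  ¬ (∀ k j → A (lookup I k) j ≡ 0ℤ)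
basis-entry≢0 {n = n} A basis A≡0 = contradiction
  (Basis.independent basis (λ _ → 1ℤ) (λ j → trans
    (Σℤ.sum-cong-≗ {suc n} (λ k → trans (ℤ.*-identityˡ _) (A≡0 k j)))
    (Σℤ.sum-replicate-zero (suc n))) zero) λ ()

∣∣≤sum≤0⇒≡0 : ∀ {n γ} (f : Vector ℤ n) → sumℕ (λ i → ℤ.∣ f i ∣) ≤ℕ γ → γ ≡ 0 → ∀ i → f i ≡ 0ℤ
∣∣≤sum≤0⇒≡0 f sum≤ refl i =
  ℤ.∣i∣≡0⇒i≡0 (ℕ.n≤0⇒n≡0 (ℕ.≤-trans (sum-coordinate≤ (λ i → ℤ.∣ f i ∣) i) sum≤))

basis⇒γ₁≢0 : ∀ {m n} (A : Matrix ℤ m (suc n)) {I} → Basis A I → γ₁ A ≢ 0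
basis⇒γ₁≢0 A {I} basis γ≡0 = basis-entry≢0 A basis λ k j →
  ∣∣≤sum≤0⇒≡0 (A (lookup I k)) (row-sum≤γ₁ A I (Basis.det≢0 basis) k) γ≡0 j

basis⇒γ∞≢0 : ∀ {m n} (A : Matrix ℤ m (suc n)) {I} → Basis A I → γ∞ A ≢ 0
basis⇒γ∞≢0 A {I} basis γ≡0 = basis-entry≢0 A basis λ k j →
  ∣∣≤sum≤0⇒≡0 (λ k → A (lookup I k) j) (column-sum≤γ∞ A I (Basis.det≢0 basis) j) γ≡0 k

-- The number of vertices

module Count {m n} (A : Matrix ℤ m n) (b : Vector ℚ m) where

  open Polyhedral A b

  module _ {∥_∥ : Vector ℕ n → ℕ} (isNorm : IsNorm n ∥_∥) .{{_ : NonZero n}} (γ : ℕ)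
    (nonZero : ∀ {I} → Basis A I → γ ≢ 0)
    (cone≤ : ∀ {I} → Basis A I → ∀ s → ∥ (λ j → ℤ.∣ cone I s j ∣) ∥ ≤ℕ γ *ℕ ∥ (λ k → suc (lookup s k)) ∥)
    where

    count-tight : ∀ k (v : Fin k → Vector ℝ n) → (∀ e → Polyhedron A b (v e)) → Injective _≡_ _≋_ v →
      (∀ e → ∃[ I ] TightBasis (v e) I) → k ≤ℕ (2 *ℕ γ) ^ n
    count-tight zero    v inside distinct tight = z≤n
    -- The basis at the first member of the family certifies γ ≠ 0; an empty family offers none and
    -- is handled separately.
    count-tight k@(suc _) v inside distinct tight =
      Packing.packing isNorm γ {{ℕ.≢-nonZero (nonZero (proj₂ (proj₂ (tight zero))))}} k
        (λ e → cone (proj₁ (tight e))) injective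
        (λ e → cone≤ (proj₂ (proj₂ (tight e))))
      where
      injective : ∀ {e e′ s s′} → (∀ j → cone (proj₁ (tight e)) s j ≡ cone (proj₁ (tight e′)) s′ j) →
        e ≡ e′ × s ≡ s′
      injective {e} {e′} {s} {s′} eq = same-cone (distinct (cones-disjoint (v e) (v e′)
        {proj₁ (tight e)} {proj₁ (tight e′)} {s} {s′}
        (inside e) (inside e′) (proj₂ (tight e)) (proj₂ (tight e′)) eq)) eq
        where
        same-cone : ∀ {e′} → e ≡ e′ → (∀ j → cone (proj₁ (tight e)) s j ≡ cone (proj₁ (tight e′)) s′ j) →
          e ≡ e′ × s ≡ s′
        same-cone refl eq = refl , cone-injective (proj₂ (proj₂ (tight e))) eq

    -- The bound on `k` is decidable and hence stable, so bases that exist only up to double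
    -- negation may be used.
    atMost : AtMost ((2 *ℕ γ) ^ n) (IsVertex (Polyhedron A b))
    atMost k v vertex distinct = decidable-stable (k ℕ.≤? (2 *ℕ γ) ^ n) λ ¬k≤ →
      ¬¬-∀ (λ e → vertex⇒tightBasis (v e) (vertex e)) λ tight →
        ¬k≤ (count-tight k v (proj₁ ∘ vertex) distinct tight)

atMost-γ : ∀ {m} n (A : Matrix ℤ m n) (b : Vector ℚ m) →
  AtMost (2 ^ n *ℕ γ₁,∞ A ^ n) (IsVertex (Polyhedron A b))
-- In dimension 0 any two points are equal vacuously, so a family of distinct ones has at most one
-- member, and the bound is 1.
atMost-γ zero A b zero          v vertex distinct = z≤n
atMost-γ zero A b (suc zero)    v vertex distinct = s≤s z≤n
atMost-γ zero A b (suc (suc k)) v vertex distinct = contradiction (distinct {zero} {suc zero} λ ()) λ ()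
atMost-γ n@(suc _) A b = subst (λ N → AtMost N (IsVertex (Polyhedron A b))) (^-distribʳ-* 2 (γ₁,∞ A) n) minimum
  where
  open Polyhedral A b
  minimum : AtMost ((2 *ℕ γ₁,∞ A) ^ n) (IsVertex (Polyhedron A b))
  minimum = [
    (λ eq → subst (λ γ → AtMost ((2 *ℕ γ) ^ n) (IsVertex (Polyhedron A b))) (sym eq)
      (Count.atMost A b (sum-isNorm n) (γ₁ A) (basis⇒γ₁≢0 A) cone-sum≤)) ,
    (λ eq → subst (λ γ → AtMost ((2 *ℕ γ) ^ n) (IsVertex (Polyhedron A b))) (sym eq)
      (Count.atMost A b (maximum-isNorm n) (γ∞ A) (basis⇒γ∞≢0 A) cone-max≤)) ]′
    (ℕ.⊓-sel (γ₁ A) (γ∞ A))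

lemma4 : (m n : ℕ) (A : Matrix ℤ m n) (b : Vector ℚ m) → HasRank A n →
    AtMost (2 ^ n *ℕ γ₁,∞ A ^ n) (IsVertex (Polyhedron A b)) ×
    (2 ^ n *ℕ γ₁,∞ A ^ n ≤ℕ (2 *ℕ ∥ A ∥max) ^ n *ℕ maxts A ^ n)
lemma4 m n A b _ = atMost-γ n A b , (begin
  2 ^ n *ℕ γ₁,∞ A ^ n                    ≡⟨ ^-distribʳ-* 2 (γ₁,∞ A) n ⟨
  (2 *ℕ γ₁,∞ A) ^ n                      ≤⟨ ℕ.^-monoˡ-≤ n (ℕ.*-monoʳ-≤ 2 (γ₁,∞≤ A)) ⟩
  (2 *ℕ (∥ A ∥max *ℕ maxts A)) ^ n       ≡⟨ cong (_^ n) (ℕ.*-assoc 2 ∥ A ∥max (maxts A)) ⟨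
  (2 *ℕ ∥ A ∥max *ℕ maxts A) ^ n         ≡⟨ ^-distribʳ-* (2 *ℕ ∥ A ∥max) (maxts A) n ⟩
  (2 *ℕ ∥ A ∥max) ^ n *ℕ maxts A ^ n     ∎)
  where open ℕ.≤-Reasoning
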